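{- The data $G\mathcal A_f$ form a category, where: the objects are the algebraizable logics; a morphism $a\to a'$ is a Glivenko's context $(h:a\to a',\rho)$; the composite of $(h:a\to a',\rho)$ and $(h':a'\to a'',\rho')$ is $(h'\circ h:a\to a'',\ \rho'\bullet\rho)$ with $(\rho'\bullet\rho)_M=\rho_M\circ\rho'_{L_hM}$ for $M\in QV(a)$; and the identity of $a$ is $(Id_a,(Id_M)_M)$.
   Context: **Logics.** A signature is a sequence $\Sigma=(\Sigma_n)_{n\in\mathbb{N}}$ of pairwise disjoint sets ($\Sigma_n$: the $n$-ary connectives). $X=\{x_0,x_1,\dots\}$ is a fixed countable set of variables, $F(\Sigma)$ is the absolutely free $\Sigma$-algebra (set of formulas) on $X$, and $F(\Sigma)[n]$ is the set of formulas whose variables are exactly $x_0,\dots,x_{n-1}$. A logic is a pair $a=(\Sigma,\vdash)$ with $\vdash\subseteq\mathcal P(F(\Sigma))\times F(\Sigma)$ a reflexive, monotone, finitary, structural (substitution-invariant) relation satisfying cut. A flexible morphism $f:\Sigma\to\Sigma'$ is a family of functions $\Sigma_n\to F(\Sigma')[n]$; it extends to $\check f:F(\Sigma)\to F(\Sigma')$ by $\check f(x)=x$ for $x\in X$ and $\check f(c_n(\psi_0,\dots,\psi_{n-1}))=f(c_n)[x_0|\check f(\psi_0),\dots,x_{n-1}|\check f(\psi_{n-1})]$. A flexible translation $f:(\Sigma,\vdash)\to(\Sigma',\vdash')$ is a flexible morphism such that $\Gamma\vdash\psi$ implies $\check f[\Gamma]\vdash'\check f(\psi)$. Composition is by $f'\circ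 f:\ c\mapsto\check f'(f(c))$; the identity sends $c_n$ to $c_n(x_0,\dots,x_{n-1})$. **Algebraizable logics** (Blok–Pigozzi). For a class $K$ of $\Sigma$-algebras, $\models_K$ is the equational consequence of $K$. A logic $a=(\Sigma,\vdash)$ is algebraizable if there are a class $K$, a finite set $\tau(p)=\{(\varepsilon^j(p),\delta^j(p))\}_{j}$ of equations in one variable and a finite set $\Delta(p,q)$ of formulas in two variables such that $\Gamma\vdash\varphi$ iff $\bigcup_{\gamma\in\Gamma}\tau(\gamma)\models_K\tau(\varphi)$, and $\varphi\equiv\psi$ is interderivable under $\models_K$ with $\tau(\varphi\Delta\psi)$. Then $(\tau,\Delta)$ is an algebraizing pair, and there is a unique quasivariety $QV(a)$ that can serve as $K$. $\mathcal A_f$ is the category of algebraizable logics and flexible translations preserving algebraizing pairs, i.e. sending an algebraizing pair $(\tau,\Delta)$ of the source to an algebraizing pair $(\check f(\tau),\check f(\Delta))$ of the target. **Functors on algebras.** For $h:a\to a'$ in $\mathcal A_f$ and a $\Sigma'$-algebra $M$, $h^\star(M)$ is the $\Sigma$-algebra on the same set with $c_n^{h^\star(M)}=h(c_n)^M$, and $h^\star$ is the identity on maps; thus $(h'\circ h)^\star=h^\star\circ h'^\star$. It restricts to $h^\star{\restriction}:QV(a')\to QV(a)$, which has a left adjoint, written $L_h:QV(a)\to QV(a')$, with unit $\bar\partial:Id\Rightarrow h^\star{\restriction}\circ L_h$. Convention: left adjoints are chosen compatibly with composition, i.e. $L_{h'\circ h}=L_{h'}\circ L_h$ (identified, if necessary,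 along the canonical isomorphism), the unit of $L_{h'\circ h}\dashv(h'\circ h)^\star$ being the composite $M\xrightarrow{\bar\partial_M}h^\star L_hM\xrightarrow{h^\star(\bar\partial'_{L_hM})}h^\star h'^\star L_{h'}L_hM$, and $L_{Id_a}=Id$ with identity unit. **Glivenko's context.** A pair $(h:a\to a',\rho)$ with $h\in\mathcal A_f(a,a')$ and $\rho:h^\star{\restriction}\circ L_h\Rightarrow Id$ a natural transformation (of endofunctors of $QV(a)$) which is a section of the unit: $\bar\partial_M\circ\rho_M=id$ for all $M\in QV(a)$. In the composition formula, $\rho'_{L_hM}$ denotes the map underlying $h^\star(\rho'_{L_hM}):h^\star h'^\star L_{h'}L_hM\to h^\star L_hM$. -}

module Defs where

open import Level using (Level; _⊔_) renaming (suc to lsuc)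
open import Data.Nat.Base using (ℕ)
open import Data.Fin.Base using (Fin; zero; suc)
open import Data.Product.Base using (Σ; Σ-syntax; ∃; ∃-syntax; _×_; _,_; proj₁; proj₂)
open import Data.List.Base as List using (List; []; _∷_)
open import Data.List.Properties as List using ()
open import Data.List.Membership.Propositional using (find; lose) renaming (_∈_ to _∈ˡ_)
open import Data.List.Membership.Propositional.Properties using (∈-map⁺; ∈-map⁻; ∈-concatMap⁺; ∈-concatMap⁻)
open import Data.List.Relation.Unary.Any using (here; there)
open import Data.Vec.Base as Vec using (Vec; []; _∷_; lookup; tabulate)
open import Data.Vec.Properties using (lookup∘tabulate; lookup-map; map-id; map-∘)
open import Data.Vec.Relation.Binary.Pointwise.Inductive as Pointwise using (Pointwise; []; _∷_)
open import Data.Vec.Relation.Unary.Any as Any using (Any; here; there)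
open import Data.Vec.Relation.Unary.Any.Properties using (tabulate⁺)
open import Function.Base using (_∘_; const; case_of_)
open import Function.Bundles using (Func; _⇔_; mk⇔; Equivalence)
open import Relation.Binary.Bundles using (Setoid)
open import Relation.Binary.Core using (Rel)
open import Relation.Binary.Structures using (IsEquivalence)
open import Relation.Binary.PropositionalEquality as ≡ using (_≡_; refl)
open import Relation.Unary using (Pred; _∈_; _⊆_)

private
  variable
    o ℓ e o′ ℓ′ e′ o″ ℓ″ e″ : Level
    u x y z : Level
    X : Set x
    Y : Set y
    Z : Set z
    n : ℕ

record IsCategory (Obj : Set o) (_⇒_ : Obj → Obj → Set ℓ)
                  (_≈_ : ∀ {A B} → Rel (A ⇒ B) e)
                  (id : ∀ {A} → A ⇒ A)
                  (_∙_ : ∀ {A B C} → B ⇒ C → A ⇒ B → A ⇒ C) : Set (o ⊔ ℓ ⊔ e) where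
  field
    equiv     : ∀ {A B} → IsEquivalence (_≈_ {A} {B})
    ∙-resp-≈  : ∀ {A B C} {f f′ : B ⇒ C} {g g′ : A ⇒ B} →
                f ≈ f′ → g ≈ g′ → (f ∙ g) ≈ (f′ ∙ g′)
    assoc     : ∀ {A B C D} {f : A ⇒ B} {g : B ⇒ C} {h : C ⇒ D} →
                ((h ∙ g) ∙ f) ≈ (h ∙ (g ∙ f))
    identityˡ : ∀ {A B} {f : A ⇒ B} → (id ∙ f) ≈ f
    identityʳ : ∀ {A B} {f : A ⇒ B} → (f ∙ id) ≈ f

record Category (o ℓ e : Level) : Set (lsuc (o ⊔ ℓ ⊔ e)) where
  infix  4 _⇒_ _≈_
  infixr 9 _∙_
  field
    Obj        : Set o
    _⇒_        : Obj → Obj → Set ℓ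
    _≈_        : ∀ {A B} → Rel (A ⇒ B) e
    id         : ∀ {A} → A ⇒ A
    _∙_        : ∀ {A B C} → B ⇒ C → A ⇒ B → A ⇒ C
    isCategory : IsCategory Obj _⇒_ _≈_ id _∙_
  open IsCategory isCategory public

record Functor (C : Category o ℓ e) (D : Category o′ ℓ′ e′) :
               Set (o ⊔ ℓ ⊔ e ⊔ o′ ⊔ ℓ′ ⊔ e′) where
  private
    module C = Category C
    module D = Category D
  field
    F₀           : C.Obj → D.Obj
    F₁           : ∀ {A B} → A C.⇒ B → F₀ A D.⇒ F₀ B
    F-resp-≈     : ∀ {A B} {f g : A C.⇒ B} → f C.≈ g → F₁ f D.≈ F₁ g
    identity     : ∀ {A} → F₁ (C.id {A}) D.≈ D.id
    homomorphism : ∀ {A B E} {f : A C.⇒ B} {g : B C.⇒ E} →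
                   F₁ (g C.∙ f) D.≈ (F₁ g D.∙ F₁ f)

Idᶠ : {C : Category o ℓ e} → Functor C C
Idᶠ {C = C} = record
  { F₀ = λ A → A ; F₁ = λ f → f ; F-resp-≈ = λ p → p
  ; identity = refl≈ ; homomorphism = refl≈ }
  where
  open Category C
  refl≈ : ∀ {A B} {f : A ⇒ B} → f ≈ f
  refl≈ = IsEquivalence.refl equiv

infixr 9 _∘ᶠ_
_∘ᶠ_ : {C : Category o ℓ e} {D : Category o′ ℓ′ e′} {E : Category o″ ℓ″ e″} →
       Functor D E → Functor C D → Functor C E
_∘ᶠ_ {E = E} G F = record
  { F₀ = λ A → G.F₀ (F.F₀ A)
  ; F₁ = λ f → G.F₁ (F.F₁ f)
  ; F-resp-≈ = λ p → G.F-resp-≈ (F.F-resp-≈ p)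
  ; identity = trans≈ (G.F-resp-≈ F.identity) G.identity
  ; homomorphism = trans≈ (G.F-resp-≈ F.homomorphism) G.homomorphism }
  where
  module F = Functor F
  module G = Functor G
  open Category E
  trans≈ : ∀ {A B} {f g h : A ⇒ B} → f ≈ g → g ≈ h → f ≈ h
  trans≈ = IsEquivalence.trans equiv

module _ {C : Category o ℓ e} {D : Category o′ ℓ′ e′} (F G : Functor C D) where
  private
    module C = Category C
    module D = Category D
    module F = Functor F
    module G = Functor G

  Components : Set (o ⊔ ℓ′)
  Components = ∀ A → F.F₀ A D.⇒ G.F₀ A

  IsNatural : Components → Set (o ⊔ ℓ ⊔ e′)
  IsNatural η = ∀ {A B} (f : A C.⇒ B) → (η B D.∙ F.F₁ f) D.≈ (G.F₁ f D.∙ η A)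

record LeftAdjoint {C : Category o ℓ e} {D : Category o′ ℓ′ e′} (R : Functor D C) :
                   Set (o ⊔ ℓ ⊔ e ⊔ o′ ⊔ ℓ′ ⊔ e′) where
  private
    module C = Category C
    module D = Category D
    module R = Functor R
  field
    L              : Functor C D
    unit           : Components Idᶠ (R ∘ᶠ L)
    unit-natural   : IsNatural Idᶠ (R ∘ᶠ L) unit
    counit         : Components (L ∘ᶠ R) Idᶠ
    counit-natural : IsNatural (L ∘ᶠ R) Idᶠ counit
  open Functor L public using () renaming (F₀ to L₀; F₁ to L₁)
  field
    zig            : ∀ A → (counit (L₀ A) D.∙ L₁ (unit A)) D.≈ D.id
    zag            : ∀ B → (R.F₁ (counit B) C.∙ unit (R.F₀ B)) C.≈ C.id

  transpose : ∀ {A B} → A C.⇒ R.F₀ B → L₀ A D.⇒ B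
  transpose {B = B} f = counit B D.∙ L₁ f

-- Indexing by the arity makes the sets of connectives disjoint.
Signature : ∀ u → Set (lsuc u)
Signature u = ℕ → Set u

data Term (S : Signature u) (X : Set x) : Set (u ⊔ x) where
  var : X → Term S X
  op  : S n → Vec (Term S X) n → Term S X

Formula : Signature u → Set u
Formula S = Term S ℕ

infix 4 _occursIn_
data _occursIn_ {S : Signature u} {X : Set x} (i : X) : Term S X → Set (u ⊔ x) where
  var : i occursIn var i
  op  : {c : S n} {ts : Vec (Term S X) n} → Any (i occursIn_) ts → i occursIn op c ts

infixl 8 _[_] _[_]*
mutual
  _[_] : {S : Signature u} → Term S X → (X → Term S Y) → Term S Y
  var i   [ σ ] = σ i
  op c ts [ σ ] = op c (ts [ σ ]*)

  _[_]* : {S : Signature u} → Vec (Term S X) n → (X → Term S Y) → Vec (Term S Y) n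
  []       [ σ ]* = []
  (t ∷ ts) [ σ ]* = t [ σ ] ∷ ts [ σ ]*

-- F(S)[n]: a formula in the variables x₀,…,xₙ₋₁ is a term over Fin n, and
-- "exactly these variables" means that each of them occurs.
record ExactFormula (S : Signature u) (n : ℕ) : Set u where
  constructor exact
  field
    term  : Term S (Fin n)
    occur : ∀ i → i occursIn term
open ExactFormula public

FlexibleMorphism : Signature u → Signature u → Set u
FlexibleMorphism S S′ = ∀ {n} → S n → ExactFormula S′ n

mutual
  extend : {S S′ : Signature u} → FlexibleMorphism S S′ → Term S X → Term S′ X
  extend f (var i)   = var i
  extend f (op c ts) = term (f c) [ lookup (extend* f ts) ]

  extend* : {S S′ : Signature u} → FlexibleMorphism S S′ → Vec (Term S X) n → Vec (Term S′ X) n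
  extend* f []       = []
  extend* f (t ∷ ts) = extend f t ∷ extend* f ts

mutual
  []-cong : {S : Signature u} (t : Term S X) {σ σ′ : X → Term S Y} →
            (∀ i → σ i ≡ σ′ i) → t [ σ ] ≡ t [ σ′ ]
  []-cong (var i)   p = p i
  []-cong (op c ts) p = ≡.cong (op c) ([]*-cong ts p)

  []*-cong : {S : Signature u} (ts : Vec (Term S X) n) {σ σ′ : X → Term S Y} →
             (∀ i → σ i ≡ σ′ i) → ts [ σ ]* ≡ ts [ σ′ ]*
  []*-cong []       p = refl
  []*-cong (t ∷ ts) p = ≡.cong₂ _∷_ ([]-cong t p) ([]*-cong ts p)

mutual
  []-assoc : {S : Signature u} (t : Term S X) (σ : X → Term S Y) (σ′ : Y → Term S Z) →
             t [ σ ] [ σ′ ] ≡ t [ (λ i → σ i [ σ′ ]) ]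
  []-assoc (var i)   σ σ′ = refl
  []-assoc (op c ts) σ σ′ = ≡.cong (op c) ([]*-assoc ts σ σ′)

  []*-assoc : {S : Signature u} (ts : Vec (Term S X) n) (σ : X → Term S Y) (σ′ : Y → Term S Z) →
              ts [ σ ]* [ σ′ ]* ≡ ts [ (λ i → σ i [ σ′ ]) ]*
  []*-assoc []       σ σ′ = refl
  []*-assoc (t ∷ ts) σ σ′ = ≡.cong₂ _∷_ ([]-assoc t σ σ′) ([]*-assoc ts σ σ′)

lookup-[]* : {S : Signature u} (ts : Vec (Term S X) n) (σ : X → Term S Y) (i : Fin n) →
             lookup (ts [ σ ]*) i ≡ lookup ts i [ σ ]
lookup-[]* (t ∷ ts) σ zero    = refl
lookup-[]* (t ∷ ts) σ (suc i) = lookup-[]* ts σ i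

lookup-extend* : {S S′ : Signature u} (f : FlexibleMorphism S S′)
                 (ts : Vec (Term S X) n) (i : Fin n) →
                 lookup (extend* f ts) i ≡ extend f (lookup ts i)
lookup-extend* f (t ∷ ts) zero    = refl
lookup-extend* f (t ∷ ts) (suc i) = lookup-extend* f ts i

mutual
  extend-[] : {S S′ : Signature u} (f : FlexibleMorphism S S′) (t : Term S X) (σ : X → Term S Y) →
              extend f (t [ σ ]) ≡ extend f t [ (λ i → extend f (σ i)) ]
  extend-[] f (var i)   σ = refl
  extend-[] f (op c ts) σ = ≡.trans
    ([]-cong (term (f c)) (λ i → ≡.trans
      (≡.cong (λ us → lookup us i) (extend*-[] f ts σ))
      (lookup-[]* (extend* f ts) _ i)))
    (≡.sym ([]-assoc (term (f c)) (lookup (extend* f ts)) (λ i → extend f (σ i))))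

  extend*-[] : {S S′ : Signature u} (f : FlexibleMorphism S S′) (ts : Vec (Term S X) n)
               (σ : X → Term S Y) →
               extend* f (ts [ σ ]*) ≡ extend* f ts [ (λ i → extend f (σ i)) ]*
  extend*-[] f []       σ = refl
  extend*-[] f (t ∷ ts) σ = ≡.cong₂ _∷_ (extend-[] f t σ) (extend*-[] f ts σ)

mutual
  occurs-[] : {S : Signature u} {t : Term S X} {σ : X → Term S Y} {j : X} {i : Y} →
              j occursIn t → i occursIn σ j → i occursIn t [ σ ]
  occurs-[] var    q = q
  occurs-[] (op p) q = op (occurs-[]* p q)

  occurs-[]* : {S : Signature u} {ts : Vec (Term S X) n} {σ : X → Term S Y} {j : X} {i : Y} →
               Any (j occursIn_) ts → i occursIn σ j → Any (i occursIn_) (ts [ σ ]*)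
  occurs-[]* (here p)  q = here (occurs-[] p q)
  occurs-[]* (there p) q = there (occurs-[]* p q)

any-lookup : {P : Pred X y} {xs : Vec X n} (p : Any P xs) → P (lookup xs (Any.index p))
any-lookup (here p)  = p
any-lookup (there p) = any-lookup p

mutual
  occurs-extend : {S S′ : Signature u} (f : FlexibleMorphism S S′) {t : Term S X} {i : X} →
                  i occursIn t → i occursIn extend f t
  occurs-extend f var = var
  occurs-extend f (op {c = c} p) =
    occurs-[] (occur (f c) _) (any-lookup (occurs-extend* f p))

  occurs-extend* : {S S′ : Signature u} (f : FlexibleMorphism S S′)
                   {ts : Vec (Term S X) n} {i : X} →
                   Any (i occursIn_) ts → Any (i occursIn_) (extend* f ts)
  occurs-extend* f (here p)  = here (occurs-extend f p)
  occurs-extend* f (there p) = there (occurs-extend* f p)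

infix 4 _≈ᵐ_
_≈ᵐ_ : {S S′ : Signature u} → FlexibleMorphism S S′ → FlexibleMorphism S S′ → Set u
_≈ᵐ_ {S = S} f g = ∀ {n} (c : S n) → term (f c) ≡ term (g c)

idᵐ : {S : Signature u} → FlexibleMorphism S S
idᵐ c = exact (op c (tabulate var)) (λ i → op (tabulate⁺ i var))

infixr 9 _∘ᵐ_
_∘ᵐ_ : {S S′ S″ : Signature u} →
       FlexibleMorphism S′ S″ → FlexibleMorphism S S′ → FlexibleMorphism S S″
(f′ ∘ᵐ f) c = exact (extend f′ (term (f c))) (λ i → occurs-extend f′ (occur (f c) i))

lookup-ext : {xs ys : Vec X n} → (∀ i → lookup xs i ≡ lookup ys i) → xs ≡ ys
lookup-ext {xs = []}     {[]}     p = refl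
lookup-ext {xs = x ∷ xs} {y ∷ ys} p = ≡.cong₂ _∷_ (p zero) (lookup-ext (p ∘ suc))

tabulate-var-[] : {S : Signature u} (ts : Vec (Term S X) n) →
                  tabulate var [ lookup ts ]* ≡ ts
tabulate-var-[] ts = lookup-ext λ i → ≡.trans
  (lookup-[]* (tabulate var) (lookup ts) i)
  (≡.cong (_[ lookup ts ]) (lookup∘tabulate var i))

mutual
  extend-id : {S : Signature u} (t : Term S X) → extend idᵐ t ≡ t
  extend-id (var i)   = refl
  extend-id (op c ts) = ≡.cong (op c)
    (≡.trans (tabulate-var-[] (extend* idᵐ ts)) (extend*-id ts))

  extend*-id : {S : Signature u} (ts : Vec (Term S X) n) → extend* idᵐ ts ≡ ts
  extend*-id []       = refl
  extend*-id (t ∷ ts) = ≡.cong₂ _∷_ (extend-id t) (extend*-id ts)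

mutual
  extend-∘ : {S S′ S″ : Signature u} (f′ : FlexibleMorphism S′ S″) (f : FlexibleMorphism S S′)
             (t : Term S X) → extend (f′ ∘ᵐ f) t ≡ extend f′ (extend f t)
  extend-∘ f′ f (var i)   = refl
  extend-∘ f′ f (op c ts) = ≡.trans
    ([]-cong (extend f′ (term (f c))) (λ i → ≡.trans
      (≡.cong (λ us → lookup us i) (extend*-∘ f′ f ts))
      (lookup-extend* f′ (extend* f ts) i)))
    (≡.sym (extend-[] f′ (term (f c)) (lookup (extend* f ts))))

  extend*-∘ : {S S′ S″ : Signature u} (f′ : FlexibleMorphism S′ S″) (f : FlexibleMorphism S S′)
              (ts : Vec (Term S X) n) → extend* (f′ ∘ᵐ f) ts ≡ extend* f′ (extend* f ts)
  extend*-∘ f′ f []       = refl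
  extend*-∘ f′ f (t ∷ ts) = ≡.cong₂ _∷_ (extend-∘ f′ f t) (extend*-∘ f′ f ts)

image : {A B : Set u} → (A → B) → Pred A u → Pred B u
image g Γ ψ = ∃[ φ ] φ ∈ Γ × ψ ≡ g φ

fromList : {A : Set u} → List A → Pred A u
fromList as a = a ∈ˡ as

record Logic (u : Level) : Set (lsuc u) where
  infix 4 _⊢_
  field
    sig        : Signature u
    _⊢_        : Pred (Formula sig) u → Formula sig → Set u
    reflexive  : ∀ {Γ φ} → φ ∈ Γ → Γ ⊢ φ
    monotone   : ∀ {Γ Γ′ φ} → Γ ⊆ Γ′ → Γ ⊢ φ → Γ′ ⊢ φ
    cut        : ∀ {Γ Γ′ φ} → (∀ {ψ} → ψ ∈ Γ′ → Γ ⊢ ψ) → Γ′ ⊢ φ → Γ ⊢ φ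
    finitary   : ∀ {Γ φ} → Γ ⊢ φ → ∃[ Γ₀ ] fromList Γ₀ ⊆ Γ × fromList Γ₀ ⊢ φ
    structural : ∀ {Γ φ} (σ : ℕ → Formula sig) → Γ ⊢ φ → image _[ σ ] Γ ⊢ φ [ σ ]

-- Carriers are setoids because the left adjoints between quasivarieties are quotients
-- of term algebras.  Empty carriers are allowed.
record Algebra (S : Signature u) : Set (lsuc u) where
  field
    setoid : Setoid u u
  open Setoid setoid public
  field
    interp      : S n → Vec Carrier n → Carrier
    interp-cong : (c : S n) {as bs : Vec Carrier n} →
                  Pointwise _≈_ as bs → interp c as ≈ interp c bs

record Hom {S : Signature u} (M N : Algebra S) : Set u where
  private
    module M = Algebra M
    module N = Algebra N
  field
    func : Func M.setoid N.setoid
  open Func func public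
  field
    homo : (c : S n) (as : Vec M.Carrier n) →
           to (M.interp c as) N.≈ N.interp c (Vec.map to as)

infix 4 _≈ʰ_
_≈ʰ_ : {S : Signature u} {M N : Algebra S} → Rel (Hom M N) u
_≈ʰ_ {N = N} f g = ∀ a → Hom.to f a N.≈ Hom.to g a
  where module N = Algebra N

module _ {S : Signature u} (A : Algebra S) where
  open Algebra A using (Carrier; _≈_; interp; interp-cong)

  mutual
    eval : Term S X → (X → Carrier) → Carrier
    eval (var i)   v = v i
    eval (op c ts) v = interp c (eval* ts v)

    eval* : Vec (Term S X) n → (X → Carrier) → Vec Carrier n
    eval* []       v = []
    eval* (t ∷ ts) v = eval t v ∷ eval* ts v

  mutual
    eval-cong : (t : Term S X) {v w : X → Carrier} →
                (∀ i → v i ≈ w i) → eval t v ≈ eval t w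
    eval-cong (var i)   p = p i
    eval-cong (op c ts) p = interp-cong c (eval*-cong ts p)

    eval*-cong : (ts : Vec (Term S X) n) {v w : X → Carrier} →
                 (∀ i → v i ≈ w i) → Pointwise _≈_ (eval* ts v) (eval* ts w)
    eval*-cong []       p = []
    eval*-cong (t ∷ ts) p = eval-cong t p ∷ eval*-cong ts p

  mutual
    eval-[] : (t : Term S X) (σ : X → Term S Y) (v : Y → Carrier) →
              eval (t [ σ ]) v ≡ eval t (λ i → eval (σ i) v)
    eval-[] (var i)   σ v = refl
    eval-[] (op c ts) σ v = ≡.cong (interp c) (eval*-[] ts σ v)

    eval*-[] : (ts : Vec (Term S X) n) (σ : X → Term S Y) (v : Y → Carrier) →
               eval* (ts [ σ ]*) v ≡ eval* ts (λ i → eval (σ i) v)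
    eval*-[] []       σ v = refl
    eval*-[] (t ∷ ts) σ v = ≡.cong₂ _∷_ (eval-[] t σ v) (eval*-[] ts σ v)

  lookup-eval* : (ts : Vec (Term S X) n) (v : X → Carrier) (i : Fin n) →
                 lookup (eval* ts v) i ≡ eval (lookup ts i) v
  lookup-eval* (t ∷ ts) v zero    = refl
  lookup-eval* (t ∷ ts) v (suc i) = lookup-eval* ts v i

  eval*-tabulate : (as : Vec Carrier n) → eval* (tabulate var) (lookup as) ≡ as
  eval*-tabulate as = lookup-ext λ i → ≡.trans
    (lookup-eval* (tabulate var) (lookup as) i)
    (≡.cong (λ t → eval t (lookup as)) (lookup∘tabulate var i))

module _ {S : Signature u} {M N : Algebra S} (f : Hom M N) where
  private
    module M = Algebra M
    module N = Algebra N
    module f = Hom f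

  mutual
    hom-eval : (t : Term S X) (v : X → M.Carrier) →
               f.to (eval M t v) N.≈ eval N t (λ i → f.to (v i))
    hom-eval (var i)   v = N.refl
    hom-eval (op c ts) v = N.trans (f.homo c (eval* M ts v)) (N.interp-cong c (hom-eval* ts v))

    hom-eval* : (ts : Vec (Term S X) n) (v : X → M.Carrier) →
                Pointwise N._≈_ (Vec.map f.to (eval* M ts v)) (eval* N ts (λ i → f.to (v i)))
    hom-eval* []       v = []
    hom-eval* (t ∷ ts) v = hom-eval t v ∷ hom-eval* ts v

module _ {S : Signature u} where

  idʰ : {M : Algebra S} → Hom M M
  idʰ {M} = record
    { func = record { to = λ a → a ; cong = λ p → p }
    ; homo = λ c as → M.reflexive (≡.cong (M.interp c) (≡.sym (map-id as))) }
    where module M = Algebra M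

  infixr 9 _∘ʰ_
  _∘ʰ_ : {M N P : Algebra S} → Hom N P → Hom M N → Hom M P
  _∘ʰ_ {M} {N} {P} g f = record
    { func = record { to = λ a → g.to (f.to a) ; cong = λ p → g.cong (f.cong p) }
    ; homo = λ c as → P.trans (g.cong (f.homo c as)) (P.trans (g.homo c _)
                        (P.reflexive (≡.cong (P.interp c) (≡.sym (map-∘ g.to f.to as))))) }
    where
    module P = Algebra P
    module f = Hom f
    module g = Hom g

  ≈ʰ-isEquivalence : (M N : Algebra S) → IsEquivalence (_≈ʰ_ {M = M} {N})
  ≈ʰ-isEquivalence M N = record
    { refl = λ _ → N.refl ; sym = λ p a → N.sym (p a) ; trans = λ p q a → N.trans (p a) (q a) }
    where module N = Algebra N

  FullSubcategory : Pred (Algebra S) (lsuc u) → Category (lsuc u) u u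
  FullSubcategory Q = record
    { Obj = Σ (Algebra S) Q
    ; _⇒_ = λ M N → Hom (proj₁ M) (proj₁ N)
    ; _≈_ = λ {M} {N} → _≈ʰ_ {M = proj₁ M} {proj₁ N}
    ; id  = idʰ
    ; _∙_ = _∘ʰ_
    ; isCategory = record
      { equiv = λ {M} {N} → ≈ʰ-isEquivalence (proj₁ M) (proj₁ N)
      ; ∙-resp-≈ = λ {_} {_} {P} {f} {_} {_} {g′} p q a →
          Algebra.trans (proj₁ P) (Hom.cong f (q a)) (p (Hom.to g′ a))
      ; assoc = λ {_} {_} {_} {D} _ → Algebra.refl (proj₁ D)
      ; identityˡ = λ {_} {B} _ → Algebra.refl (proj₁ B)
      ; identityʳ = λ {_} {B} _ → Algebra.refl (proj₁ B)
      }
    }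

Equation : Signature u → Set x → Set (u ⊔ x)
Equation S X = Term S X × Term S X

module _ {S : Signature u} where

  infix 4 _,_⊩_ _⊨[_]_
  _,_⊩_ : (A : Algebra S) → (ℕ → Algebra.Carrier A) → Equation S ℕ → Set u
  A , v ⊩ (s , t) = eval A s v A.≈ eval A t v
    where module A = Algebra A

  _⊨[_]_ : Pred (Equation S ℕ) u → Pred (Algebra S) (lsuc u) → Equation S ℕ → Set (lsuc u)
  E ⊨[ K ] q = ∀ A → A ∈ K → ∀ v → (∀ {p} → p ∈ E → A , v ⊩ p) → A , v ⊩ q

record QuasiEquation (S : Signature u) : Set u where
  constructor _⟹_
  field
    premises   : List (Equation S ℕ)
    conclusion : Equation S ℕ

module _ {S : Signature u} where

  infix 4 _⊨_
  _⊨_ : Algebra S → QuasiEquation S → Set u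
  A ⊨ (E ⟹ q) = ∀ v → (∀ {p} → p ∈ˡ E → A , v ⊩ p) → A , v ⊩ q

  Mod : Pred (QuasiEquation S) (lsuc u) → Pred (Algebra S) (lsuc u)
  Mod T A = ∀ q → q ∈ T → A ⊨ q

  Th : Pred (Algebra S) (lsuc u) → Pred (QuasiEquation S) (lsuc u)
  Th K q = ∀ A → A ∈ K → A ⊨ q

  IsQuasivariety : Pred (Algebra S) (lsuc u) → Set (lsuc (lsuc u))
  IsQuasivariety Q = ∃[ T ] (∀ A → A ∈ Q ⇔ A ∈ Mod T)

module _ {S : Signature u} where

  infix 8 _⟪_⟫ _⟨_,_⟩
  _⟪_⟫ : List (Equation S (Fin 1)) → Formula S → List (Equation S ℕ)
  τ ⟪ φ ⟫ = List.map (λ (ε , δ) → ε [ const φ ] , δ [ const φ ]) τ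

  pair : Formula S → Formula S → Fin 2 → Formula S
  pair φ ψ = lookup (φ ∷ ψ ∷ [])

  _⟨_,_⟩ : List (Term S (Fin 2)) → Formula S → Formula S → List (Formula S)
  Δ ⟨ φ , ψ ⟩ = List.map _[ pair φ ψ ] Δ

  ⋃⟪_⟫ : List (Equation S (Fin 1)) → Pred (Formula S) u → Pred (Equation S ℕ) u
  ⋃⟪ τ ⟫ Γ q = ∃[ γ ] γ ∈ Γ × q ∈ˡ τ ⟪ γ ⟫

module _ (a : Logic u) where
  open Logic a

  -- τ is in the variable p = 0F and Δ in the variables p = 0F, q = 1F; the finite
  -- sets τ and Δ are lists.
  record Algebraizes (K : Pred (Algebra sig) (lsuc u)) (τ : List (Equation sig (Fin 1)))
                     (Δ : List (Term sig (Fin 2))) : Set (lsuc u) where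
    field
      ⊢⇔⊨ : ∀ {Γ φ} → Γ ⊢ φ ⇔ (∀ {q} → q ∈ˡ τ ⟪ φ ⟫ → ⋃⟪ τ ⟫ Γ ⊨[ K ] q)
      ≈⊨τΔ : ∀ {φ ψ q} → q ∈ ⋃⟪ τ ⟫ (fromList (Δ ⟨ φ , ψ ⟩)) →
             fromList ((φ , ψ) ∷ []) ⊨[ K ] q
      τΔ⊨≈ : ∀ {φ ψ} → ⋃⟪ τ ⟫ (fromList (Δ ⟨ φ , ψ ⟩)) ⊨[ K ] (φ , ψ)

  AlgebraizingPair : List (Equation sig (Fin 1)) → List (Term sig (Fin 2)) → Set (lsuc (lsuc u))
  AlgebraizingPair τ Δ = ∃[ K ] Algebraizes K τ Δ

record AlgebraizableLogic (u : Level) : Set (lsuc (lsuc u)) where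
  field
    logic         : Logic u
    algebraizable : ∃[ τ ] ∃[ Δ ] AlgebraizingPair logic τ Δ
  open Logic logic public

-- The quasivariety generated by some class witnessing algebraizability; by
-- QV-algebraizes and QV-unique below it does not depend on the witness.
QV : (a : AlgebraizableLogic u) → Pred (Algebra (AlgebraizableLogic.sig a)) (lsuc u)
QV a = let (_ , _ , K , _) = AlgebraizableLogic.algebraizable a in Mod (Th K)

module _ (a : Logic u) where
  open Logic a

  ⟨⟩-set : List (Term sig (Fin 2)) → List (Equation sig ℕ) → Pred (Formula sig) u
  ⟨⟩-set Δ E φ = ∃[ p ] p ∈ˡ E × φ ∈ˡ Δ ⟨ proj₁ p , proj₂ p ⟩

  Derivable : List (Term sig (Fin 2)) → QuasiEquation sig → Set u
  Derivable Δ (E ⟹ (s , t)) = ∀ {φ} → φ ∈ˡ Δ ⟨ s , t ⟩ → ⟨⟩-set Δ E ⊢ φ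

  module _ {K τ Δ} (alg : Algebraizes a K τ Δ) where
    open Algebraizes alg

    Th⇒Derivable : ∀ q → q ∈ Th K → Derivable Δ q
    Th⇒Derivable q K⊨q φ∈ = Equivalence.from ⊢⇔⊨ λ r∈ A A∈K v hyp →
      ≈⊨τΔ (_ , φ∈ , r∈) A A∈K v λ where
        (here refl) → K⊨q A A∈K v λ {p} p∈E →
          τΔ⊨≈ A A∈K v λ (γ , γ∈ , p′∈) → hyp (γ , (p , p∈E , γ∈) , p′∈)

    Derivable⇒Th : ∀ q → Derivable Δ q → q ∈ Th K
    Derivable⇒Th q d A A∈K v hyp = τΔ⊨≈ A A∈K v λ (φ , φ∈ , p∈) →
      Equivalence.to ⊢⇔⊨ (d φ∈) p∈ A A∈K v λ (γ , (p , p∈E , γ∈) , r∈) →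
        ≈⊨τΔ (γ , γ∈ , r∈) A A∈K v λ where
          (here refl) → hyp p∈E

    Mod-Th-algebraizes : Algebraizes a (Mod (Th K)) τ Δ
    Mod-Th-algebraizes = record
      { ⊢⇔⊨ = mk⇔ to′ (λ h → Equivalence.from ⊢⇔⊨ λ q∈ A A∈K → h q∈ A (λ q t → t A A∈K))
      ; ≈⊨τΔ = λ {φ} {ψ} {q} q∈ A A∈ → A∈ (((φ , ψ) ∷ []) ⟹ q) (≈⊨τΔ q∈)
      ; τΔ⊨≈ = λ {φ} {ψ} A A∈ v hyp →
          A∈ (⋃ˡ (Δ ⟨ φ , ψ ⟩) ⟹ (φ , ψ))
             (λ B B∈K w h → τΔ⊨≈ B B∈K w (λ (γ , γ∈ , p∈) → h (⋃ˡ⁺ γ∈ p∈))) v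
             (λ p∈ → hyp (⋃ˡ⁻ (Δ ⟨ φ , ψ ⟩) p∈))
      }
      where
      ⋃ˡ : List (Formula sig) → List (Equation sig ℕ)
      ⋃ˡ = List.concatMap (τ ⟪_⟫)
      ⋃ˡ⁺ : ∀ {Γ γ p} → γ ∈ˡ Γ → p ∈ˡ τ ⟪ γ ⟫ → p ∈ˡ ⋃ˡ Γ
      ⋃ˡ⁺ γ∈ p∈ = ∈-concatMap⁺ (τ ⟪_⟫) (lose γ∈ p∈)
      ⋃ˡ⁻ : ∀ Γ {p} → p ∈ˡ ⋃ˡ Γ → p ∈ ⋃⟪ τ ⟫ (fromList Γ)
      ⋃ˡ⁻ Γ p∈ = find (∈-concatMap⁻ (τ ⟪_⟫) {xs = Γ} p∈)
      to′ : ∀ {Γ φ} → Γ ⊢ φ → ∀ {q} → q ∈ˡ τ ⟪ φ ⟫ → ⋃⟪ τ ⟫ Γ ⊨[ Mod (Th K) ] q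
      to′ d {q} q∈ A A∈ v hyp =
        let (Γ₀ , Γ₀⊆Γ , d₀) = finitary d in
        A∈ (⋃ˡ Γ₀ ⟹ q)
           (λ B B∈K w h →
              Equivalence.to ⊢⇔⊨ d₀ q∈ B B∈K w (λ (γ , γ∈ , p∈) → h (⋃ˡ⁺ γ∈ p∈)))
           v
           (λ p∈ → let (γ , γ∈ , r∈) = ⋃ˡ⁻ Γ₀ p∈ in hyp (γ , Γ₀⊆Γ γ∈ , r∈))

  module _ {K τ Δ K₂ τ₂ Δ₂} (alg : Algebraizes a K τ Δ) (alg₂ : Algebraizes a K₂ τ₂ Δ₂) where
    private
      module ₁ = Algebraizes alg
      module ₂ = Algebraizes alg₂

    Δ⊢Δ₂ : ∀ {φ ψ χ} → χ ∈ˡ Δ₂ ⟨ φ , ψ ⟩ → fromList (Δ ⟨ φ , ψ ⟩) ⊢ χ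
    Δ⊢Δ₂ {φ} {ψ} χ∈ with ∈-map⁻ _ χ∈
    ... | t , t∈ , refl = Equivalence.from ₁.⊢⇔⊨ λ q∈ A A∈K v hyp →
      case ∈-map⁻ _ q∈ of λ where
        ((ε , δ) , q∈τ , refl) →
          let open Algebra A using (_≈_; trans; sym) renaming (refl to ≈-refl; reflexive to ≡⇒≈)
              φ≈ψ : eval A φ v ≈ eval A ψ v
              φ≈ψ = ₁.τΔ⊨≈ A A∈K v hyp
              move : (s : Term sig (Fin 1)) →
                     eval A (s [ const (t [ pair φ ψ ]) ]) v ≈ eval A (s [ const (t [ pair φ φ ]) ]) v
              move s = trans (≡⇒≈ (eval-[] A s _ v))
                (trans (eval-cong A s (λ _ → trans (≡⇒≈ (eval-[] A t _ v))
                  (trans (eval-cong A t (λ { zero → ≈-refl ; (suc zero) → sym φ≈ψ }))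
                    (≡⇒≈ (≡.sym (eval-[] A t _ v))))))
                  (≡⇒≈ (≡.sym (eval-[] A s _ v))))
              q′∈ : (ε [ const (t [ pair φ φ ]) ] , δ [ const (t [ pair φ φ ]) ])
                    ∈ˡ τ ⟪ t [ pair φ φ ] ⟫
              q′∈ = ∈-map⁺ _ q∈τ
              theorem : fromList [] ⊢ t [ pair φ φ ]
              theorem = Equivalence.from ₂.⊢⇔⊨ λ r∈ B B∈K w _ →
                ₂.≈⊨τΔ (_ , ∈-map⁺ _ t∈ , r∈) B B∈K w λ { (here refl) → Algebra.refl B }
          in trans (move ε)
               (trans (Equivalence.to ₁.⊢⇔⊨ theorem q′∈ A A∈K v λ { (_ , () , _) })
                 (sym (move δ)))

  module _ {K τ Δ K₂ τ₂ Δ₂} (alg : Algebraizes a K τ Δ) (alg₂ : Algebraizes a K₂ τ₂ Δ₂) where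

    Th⊆Th : ∀ q → q ∈ Th K → q ∈ Th K₂
    Th⊆Th (E ⟹ q) q∈ = Derivable⇒Th alg₂ (E ⟹ q) λ φ∈ →
      cut (λ ψ∈ → cut (λ (p , p∈ , χ∈) → monotone (λ r∈ → p , p∈ , r∈) (Δ⊢Δ₂ alg₂ alg χ∈))
                      (Th⇒Derivable alg (E ⟹ q) q∈ ψ∈))
          (Δ⊢Δ₂ alg alg₂ φ∈)

Mod-Th-idem : {S : Signature u} {Q : Pred (Algebra S) (lsuc u)} → IsQuasivariety Q →
              ∀ A → A ∈ Q ⇔ A ∈ Mod (Th Q)
Mod-Th-idem (T , Q⇔T) A = mk⇔
  (λ A∈Q q t → t A A∈Q)
  (λ A∈ → Equivalence.from (Q⇔T A) λ q q∈T → A∈ q λ B B∈Q → Equivalence.to (Q⇔T B) B∈Q q q∈T)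

module _ (a : AlgebraizableLogic u) where
  open AlgebraizableLogic a

  QV-isQuasivariety : IsQuasivariety (QV a)
  QV-isQuasivariety = _ , λ A → mk⇔ (λ p → p) (λ p → p)

  QV-algebraizes : ∀ {τ Δ} → AlgebraizingPair logic τ Δ → Algebraizes logic (QV a) τ Δ
  QV-algebraizes (K , alg) = record
    { ⊢⇔⊨ = mk⇔ (λ d {q} q∈ A A∈ → Equivalence.to M.⊢⇔⊨ d {q} q∈ A (move A A∈))
                (λ h → Equivalence.from M.⊢⇔⊨ λ {q} q∈ A A∈ → h {q} q∈ A (move⁻ A A∈))
    ; ≈⊨τΔ = λ q∈ A A∈ → M.≈⊨τΔ q∈ A (move A A∈)
    ; τΔ⊨≈ = λ A A∈ → M.τΔ⊨≈ A (move A A∈)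
    }
    where
    module M = Algebraizes (Mod-Th-algebraizes logic alg)
    alg₀ = proj₂ (proj₂ (proj₂ algebraizable))
    move : ∀ A → A ∈ QV a → A ∈ Mod (Th K)
    move A A∈ q q∈ = A∈ q (Th⊆Th logic alg alg₀ q q∈)
    move⁻ : ∀ A → A ∈ Mod (Th K) → A ∈ QV a
    move⁻ A A∈ q q∈ = A∈ q (Th⊆Th logic alg₀ alg q q∈)

  QV-unique : ∀ {Q τ Δ} → IsQuasivariety Q → Algebraizes logic Q τ Δ → ∀ A → A ∈ Q ⇔ A ∈ QV a
  QV-unique {Q} isQ alg A = mk⇔
    (λ A∈ q q∈ → Equivalence.to (Mod-Th-idem isQ A) A∈ q (Th⊆Th logic alg₀ alg q q∈))
    (λ A∈ → Equivalence.from (Mod-Th-idem isQ A) λ q q∈ → A∈ q (Th⊆Th logic alg alg₀ q q∈))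
    where
    alg₀ = proj₂ (proj₂ (proj₂ algebraizable))

module _ {S S′ : Signature u} (f : FlexibleMorphism S S′) where

  extendᴱ : Equation S X → Equation S′ X
  extendᴱ (s , t) = extend f s , extend f t

  extendᵀ : List (Equation S (Fin 1)) → List (Equation S′ (Fin 1))
  extendᵀ = List.map extendᴱ

  extendᴰ : List (Term S (Fin 2)) → List (Term S′ (Fin 2))
  extendᴰ = List.map (extend f)

infix 4 _⟶_
record _⟶_ (a a′ : AlgebraizableLogic u) : Set (lsuc (lsuc u)) where
  private
    module a  = AlgebraizableLogic a
    module a′ = AlgebraizableLogic a′
  field
    morphism   : FlexibleMorphism a.sig a′.sig
    translates : ∀ {Γ ψ} → Γ a.⊢ ψ → image (extend morphism) Γ a′.⊢ extend morphism ψ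
    preserves  : ∀ {τ Δ} → AlgebraizingPair a.logic τ Δ →
                 AlgebraizingPair a′.logic (extendᵀ morphism τ) (extendᴰ morphism Δ)
open _⟶_ public

infix 4 _≈ᵗ_
_≈ᵗ_ : {a a′ : AlgebraizableLogic u} → Rel (a ⟶ a′) u
h ≈ᵗ k = morphism h ≈ᵐ morphism k

abstract
  id-translates : (a : AlgebraizableLogic u) → let open AlgebraizableLogic a in
                  ∀ {Γ ψ} → Γ ⊢ ψ → image (extend idᵐ) Γ ⊢ extend idᵐ ψ
  id-translates a {Γ} {ψ} d = ≡.subst (_ ⊢_) (≡.sym (extend-id ψ))
    (monotone (λ {φ} φ∈ → φ , φ∈ , ≡.sym (extend-id φ)) d)
    where open AlgebraizableLogic a

  id-preserves : (a : AlgebraizableLogic u) → let open AlgebraizableLogic a in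
                 ∀ {τ Δ} → AlgebraizingPair logic τ Δ →
                 AlgebraizingPair logic (extendᵀ idᵐ τ) (extendᴰ idᵐ Δ)
  id-preserves a {τ} {Δ} = ≡.subst₂ (AlgebraizingPair logic)
    (≡.trans (≡.sym (List.map-id τ)) (List.map-cong
      (λ (s , t) → ≡.cong₂ _,_ (≡.sym (extend-id s)) (≡.sym (extend-id t))) τ))
    (≡.trans (≡.sym (List.map-id Δ)) (List.map-cong (λ t → ≡.sym (extend-id t)) Δ))
    where open AlgebraizableLogic a

idᵗ : {a : AlgebraizableLogic u} → a ⟶ a
idᵗ {a = a} = record
  { morphism = idᵐ ; translates = id-translates a ; preserves = id-preserves a }

module _ {a a′ a″ : AlgebraizableLogic u} (f′ : a′ ⟶ a″) (f : a ⟶ a′) where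
  private
    module a  = AlgebraizableLogic a
    module a″ = AlgebraizableLogic a″
    m  = morphism f
    m′ = morphism f′

  abstract
    ∘-translates : ∀ {Γ ψ} → Γ a.⊢ ψ → image (extend (m′ ∘ᵐ m)) Γ a″.⊢ extend (m′ ∘ᵐ m) ψ
    ∘-translates {Γ} {ψ} d = ≡.subst (_ a″.⊢_) (≡.sym (extend-∘ m′ m ψ))
      (a″.monotone (λ { (_ , (φ , φ∈ , refl) , refl) → φ , φ∈ , ≡.sym (extend-∘ m′ m φ) })
        (translates f′ (translates f d)))

    ∘-preserves : ∀ {τ Δ} → AlgebraizingPair a.logic τ Δ →
                  AlgebraizingPair a″.logic (extendᵀ (m′ ∘ᵐ m) τ) (extendᴰ (m′ ∘ᵐ m) Δ)
    ∘-preserves {τ} {Δ} p = ≡.subst₂ (AlgebraizingPair a″.logic)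
      (≡.trans (≡.sym (List.map-∘ τ)) (List.map-cong
        (λ (s , t) → ≡.cong₂ _,_ (≡.sym (extend-∘ m′ m s)) (≡.sym (extend-∘ m′ m t))) τ))
      (≡.trans (≡.sym (List.map-∘ Δ)) (List.map-cong (λ t → ≡.sym (extend-∘ m′ m t)) Δ))
      (preserves f′ (preserves f p))

  infixr 9 _∘ᵗ_
  _∘ᵗ_ : a ⟶ a″
  _∘ᵗ_ = record
    { morphism = m′ ∘ᵐ m ; translates = ∘-translates ; preserves = ∘-preserves }

module _ {S S′ : Signature u} (f : FlexibleMorphism S S′) where

  reduct : Algebra S′ → Algebra S
  reduct M = record
    { setoid      = M.setoid
    ; interp      = λ c as → eval M (term (f c)) (lookup as)
    ; interp-cong = λ c p → eval-cong M (term (f c)) (Pointwise.lookup p)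
    }
    where module M = Algebra M

  reductʰ : {M N : Algebra S′} → Hom M N → Hom (reduct M) (reduct N)
  reductʰ {M} {N} g = record
    { func = g.func
    ; homo = λ c as → N.trans (hom-eval g (term (f c)) (lookup as))
        (eval-cong N (term (f c)) (λ i → N.reflexive (≡.sym (lookup-map i g.to as))))
    }
    where
    module N = Algebra N
    module g = Hom g

  module _ (M : Algebra S′) where
    private module M = Algebra M
    mutual
      eval-reduct : (t : Term S X) (v : X → M.Carrier) →
                    eval (reduct M) t v M.≈ eval M (extend f t) v
      eval-reduct (var i)   v = M.refl
      eval-reduct (op c ts) v = M.trans
        (eval-cong M (term (f c)) (λ i → M.trans
          (Pointwise.lookup (eval*-reduct ts v) i)
          (M.reflexive (lookup-eval* M (extend* f ts) v i))))
        (M.reflexive (≡.sym (eval-[] M (term (f c)) (lookup (extend* f ts)) v)))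

      eval*-reduct : (ts : Vec (Term S X) n) (v : X → M.Carrier) →
                     Pointwise M._≈_ (eval* (reduct M) ts v) (eval* M (extend* f ts) v)
      eval*-reduct []       v = []
      eval*-reduct (t ∷ ts) v = eval-reduct t v ∷ eval*-reduct ts v

relabel : {S : Signature u} (N : Algebra S) → let module N = Algebra N in
          {i : ∀ {n} → S n → Vec N.Carrier n → N.Carrier}
          {i-cong : ∀ {n} (c : S n) {as bs} → Pointwise N._≈_ as bs → i c as N.≈ i c bs} →
          (∀ {n} (c : S n) as → i c as N.≈ N.interp c as) →
          Hom (record { setoid = N.setoid ; interp = i ; interp-cong = i-cong }) N
relabel N p = record
  { func = record { to = λ a → a ; cong = λ q → q }
  ; homo = λ c as → N.trans (p c as) (N.reflexive (≡.cong (N.interp c) (≡.sym (map-id as))))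
  }
  where module N = Algebra N

module _ {S : Signature u} (M : Algebra S) where
  private module M = Algebra M

  reduct-id : Hom (reduct idᵐ M) M
  reduct-id = relabel M λ c as → M.reflexive (≡.cong (M.interp c) (eval*-tabulate M as))

  reduct-id⁻¹ : Hom M (reduct idᵐ M)
  reduct-id⁻¹ = relabel (reduct idᵐ M) λ c as →
    M.reflexive (≡.cong (M.interp c) (≡.sym (eval*-tabulate M as)))

module _ {S S′ S″ : Signature u} (f′ : FlexibleMorphism S′ S″) (f : FlexibleMorphism S S′)
         (M : Algebra S″) where
  private module M = Algebra M

  reduct-∘ : Hom (reduct (f′ ∘ᵐ f) M) (reduct f (reduct f′ M))
  reduct-∘ = relabel (reduct f (reduct f′ M)) λ c as →
    M.sym (eval-reduct f′ M (term (f c)) (lookup as))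

  reduct-∘⁻¹ : Hom (reduct f (reduct f′ M)) (reduct (f′ ∘ᵐ f) M)
  reduct-∘⁻¹ = relabel (reduct (f′ ∘ᵐ f) M) λ c as →
    eval-reduct f′ M (term (f c)) (lookup as)

module _ {S S′ : Signature u} (f g : FlexibleMorphism S S′) (f≈g : f ≈ᵐ g) (M : Algebra S′) where
  private module M = Algebra M

  reduct-cong : Hom (reduct f M) (reduct g M)
  reduct-cong = relabel (reduct g M) λ c as →
    M.reflexive (≡.cong (λ t → eval M t (lookup as)) (f≈g c))

Derivable-extend : {a a′ : AlgebraizableLogic u} (h : a ⟶ a′) →
  let module a  = AlgebraizableLogic a
      module a′ = AlgebraizableLogic a′
      f = morphism h in
  ∀ {Δ} E q → Derivable a.logic Δ (E ⟹ q) →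
  Derivable a′.logic (extendᴰ f Δ) (List.map (extendᴱ f) E ⟹ extendᴱ f q)
Derivable-extend {a = a} {a′} h {Δ} E (s , t) d φ∈ with ∈-map⁻ _ φ∈
... | _ , δ∈ , refl with ∈-map⁻ _ δ∈
... | δ , δ∈Δ , refl = ≡.subst (_ a′.⊢_) (extend-pair δ s t)
  (a′.monotone
    (λ { (_ , ((s₁ , t₁) , p∈ , χ∈) , refl) → case ∈-map⁻ _ χ∈ of λ where
      (δ₁ , δ₁∈ , refl) → _ , ∈-map⁺ (extendᴱ f) p∈ ,
        ≡.subst (_∈ˡ _) (≡.sym (extend-pair δ₁ s₁ t₁)) (∈-map⁺ _ (∈-map⁺ (extend f) δ₁∈)) })
    (translates h (d (∈-map⁺ _ δ∈Δ))))
  where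
  module a  = AlgebraizableLogic a
  module a′ = AlgebraizableLogic a′
  f = morphism h
  extend-pair : ∀ δ s t → extend f (δ [ pair s t ]) ≡ extend f δ [ pair (extend f s) (extend f t) ]
  extend-pair δ s t = ≡.trans (extend-[] f δ (pair s t))
    ([]-cong (extend f δ) λ { zero → refl ; (suc zero) → refl })

reduct-∈-QV : {a a′ : AlgebraizableLogic u} (h : a ⟶ a′) →
              ∀ M → M ∈ QV a′ → reduct (morphism h) M ∈ QV a
reduct-∈-QV {a = a} {a′} h M M∈ (E ⟹ (s , t)) q∈ v hyp =
  M.trans (eval-reduct f M s v) (M.trans (M⊨ v hyp′) (M.sym (eval-reduct f M t v)))
  where
  module M = Algebra M
  f = morphism h
  pair-alg = proj₂ (proj₂ (AlgebraizableLogic.algebraizable a))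
  M⊨ : M ⊨ (List.map (extendᴱ f) E ⟹ extendᴱ f (s , t))
  M⊨ = Derivable⇒Th _ (QV-algebraizes a′ (preserves h pair-alg)) _
         (Derivable-extend h E (s , t) (Th⇒Derivable _ (proj₂ pair-alg) _ q∈)) M M∈
  hyp′ : ∀ {p} → p ∈ˡ List.map (extendᴱ f) E → M , v ⊩ p
  hyp′ p∈ with ∈-map⁻ _ p∈
  ... | (s₁ , t₁) , p₁∈ , refl =
    M.trans (M.sym (eval-reduct f M s₁ v)) (M.trans (hyp p₁∈) (eval-reduct f M t₁ v))

abstract
  reduct-QV : {a a′ : AlgebraizableLogic u} (h : a ⟶ a′) →
              ∀ M → M ∈ QV a′ → reduct (morphism h) M ∈ QV a
  reduct-QV = reduct-∈-QV

QVᶜ : AlgebraizableLogic u → Category (lsuc u) u u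
QVᶜ a = FullSubcategory (QV a)

infix 10 _⋆
_⋆ : {a a′ : AlgebraizableLogic u} → a ⟶ a′ → Functor (QVᶜ a′) (QVᶜ a)
h ⋆ = record
  { F₀           = λ (M , M∈) → reduct (morphism h) M , reduct-QV h M M∈
  ; F₁           = reductʰ (morphism h)
  ; F-resp-≈     = λ p → p
  ; identity     = λ {M} _ → Algebra.refl (proj₁ M)
  ; homomorphism = λ {_} {_} {M} _ → Algebra.refl (proj₁ M)
  }

-- A choice of left adjoints; one is constructed in freeAdjoints.
LeftAdjoints : ∀ u → Set (lsuc (lsuc u))
LeftAdjoints u = {a a′ : AlgebraizableLogic u} (h : a ⟶ a′) → LeftAdjoint (h ⋆)

module Free {a a′ : AlgebraizableLogic u} (h : a ⟶ a′) where
  private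
    module a  = AlgebraizableLogic a
    module a′ = AlgebraizableLogic a′
    f   = morphism h
    Δ′  = proj₁ (proj₂ a′.algebraizable)
    alg = proj₂ (proj₂ (proj₂ a′.algebraizable))

  module _ (M : Algebra a.sig) where
    private module M = Algebra M

    Terms : Set u
    Terms = Term a′.sig M.Carrier

    -- The least congruence making the inclusion of generators M → h⋆(Terms) a
    -- homomorphism and the quotient a model of the quasi-identities of QV a′.
    infix 4 _~_
    data _~_ : Rel Terms u where
      refl  : ∀ {s} → s ~ s
      sym   : ∀ {s t} → s ~ t → t ~ s
      trans : ∀ {r s t} → r ~ s → s ~ t → r ~ t
      op    : ∀ {n} (c : a′.sig n) {ss ts} → Pointwise _~_ ss ts → op c ss ~ op c ts
      gen   : ∀ {x y} → x M.≈ y → var x ~ var y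
      homo  : ∀ {n} (c : a.sig n) (xs : Vec M.Carrier n) →
              var (M.interp c xs) ~ term (f c) [ (λ i → var (lookup xs i)) ]
      quasi : ∀ E s t → Derivable a′.logic Δ′ (E ⟹ (s , t)) → (v : ℕ → Terms) →
              (∀ {p} → p ∈ˡ E → proj₁ p [ v ] ~ proj₂ p [ v ]) → s [ v ] ~ t [ v ]

    free : Algebra a′.sig
    free = record
      { setoid = record { Carrier = Terms ; _≈_ = _~_
                        ; isEquivalence = record { refl = refl ; sym = sym ; trans = trans } }
      ; interp = op
      ; interp-cong = op
      }

    mutual
      eval-free : (t : Term a′.sig X) (v : X → Terms) → eval free t v ≡ t [ v ]
      eval-free (var i)   v = refl
      eval-free (op c ts) v = ≡.cong (op c) (eval*-free ts v)

      eval*-free : (ts : Vec (Term a′.sig X) n) (v : X → Terms) → eval* free ts v ≡ ts [ v ]*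
      eval*-free []       v = refl
      eval*-free (t ∷ ts) v = ≡.cong₂ _∷_ (eval-free t v) (eval*-free ts v)

    free-QV : free ∈ QV a′
    free-QV (E ⟹ (s , t)) q∈ v hyp = ≡.subst₂ _~_ (≡.sym (eval-free s v)) (≡.sym (eval-free t v))
      (quasi E s t (Th⇒Derivable _ alg (E ⟹ (s , t)) q∈) v
        λ {p} p∈ → ≡.subst₂ _~_ (eval-free (proj₁ p) v) (eval-free (proj₂ p) v) (hyp p∈))

    inclusion : Hom M (reduct f free)
    inclusion = record
      { func = record { to = var ; cong = gen }
      ; homo = λ c xs → trans (homo c xs) (≡⇒~ (≡.sym (≡.trans
          (eval-free (term (f c)) (lookup (Vec.map var xs)))
          ([]-cong (term (f c)) (λ i → lookup-map i var xs)))))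
      }
      where
      ≡⇒~ : ∀ {s t} → s ≡ t → s ~ t
      ≡⇒~ refl = refl

    module _ (N : Algebra a′.sig) (N∈ : N ∈ QV a′) (g : Hom M (reduct f N)) where
      private
        module N = Algebra N
        module g = Hom g

      mutual
        lift-cong : ∀ {s t} → s ~ t → eval N s g.to N.≈ eval N t g.to
        lift-cong refl        = N.refl
        lift-cong (sym p)     = N.sym (lift-cong p)
        lift-cong (trans p q) = N.trans (lift-cong p) (lift-cong q)
        lift-cong (op c p)    = N.interp-cong c (lift-cong* p)
        lift-cong (gen p)     = g.cong p
        lift-cong (homo c xs) = N.trans (g.homo c xs) (N.trans
          (eval-cong N (term (f c)) (λ i → N.reflexive (lookup-map i g.to xs)))
          (N.reflexive (≡.sym (eval-[] N (term (f c)) _ g.to))))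
        lift-cong (quasi E s t d v hyp) = N.trans (N.reflexive (eval-[] N s v g.to)) (N.trans
          (N∈ (E ⟹ (s , t)) (Derivable⇒Th _ alg (E ⟹ (s , t)) d) (λ i → eval N (v i) g.to)
            λ {p} p∈ → N.trans (N.reflexive (≡.sym (eval-[] N (proj₁ p) v g.to)))
              (N.trans (lift-cong (hyp p∈)) (N.reflexive (eval-[] N (proj₂ p) v g.to))))
          (N.reflexive (≡.sym (eval-[] N t v g.to))))

        lift-cong* : ∀ {n} {ss ts : Vec Terms n} → Pointwise _~_ ss ts →
                     Pointwise N._≈_ (eval* N ss g.to) (eval* N ts g.to)
        lift-cong* []       = []
        lift-cong* (p ∷ ps) = lift-cong p ∷ lift-cong* ps

      lift : Hom free N
      lift = record
        { func = record { to = λ t → eval N t g.to ; cong = lift-cong }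
        ; homo = λ c ts → N.reflexive (≡.cong (N.interp c) (eval*-map ts))
        }
        where
        eval*-map : ∀ {n} (ts : Vec Terms n) → eval* N ts g.to ≡ Vec.map (λ t → eval N t g.to) ts
        eval*-map []       = refl
        eval*-map (t ∷ ts) = ≡.cong (_ ∷_) (eval*-map ts)

    module _ (N : Algebra a′.sig) (g k : Hom free N) where
      private
        module N = Algebra N
        module g = Hom g
        module k = Hom k

      mutual
        unique : (∀ x → g.to (var x) N.≈ k.to (var x)) → g ≈ʰ k
        unique p (var x)   = p x
        unique p (op c ts) = N.trans (g.homo c ts)
          (N.trans (N.interp-cong c (unique* p ts)) (N.sym (k.homo c ts)))

        unique* : (∀ x → g.to (var x) N.≈ k.to (var x)) → ∀ {n} (ts : Vec Terms n) →
                  Pointwise N._≈_ (Vec.map g.to ts) (Vec.map k.to ts)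
        unique* p []       = []
        unique* p (t ∷ ts) = unique p t ∷ unique* p ts

  private
    L-map : {M N : Algebra a.sig} → Hom M N → Hom (free M) (free N)
    L-map {M} {N} g = lift M (free N) (free-QV N) (inclusion N ∘ʰ g)

    ε : (N : Algebra a′.sig) → N ∈ QV a′ → Hom (free (reduct f N)) N
    ε N N∈ = lift (reduct f N) N N∈ idʰ

  leftAdjoint : LeftAdjoint (h ⋆)
  leftAdjoint = record
    { L = record
      { F₀ = λ (M , _) → free M , free-QV M
      ; F₁ = L-map
      ; F-resp-≈ = λ {(A , _)} {(B , _)} {g} {k} p →
          unique A (free B) (L-map g) (L-map k) (λ x → gen (p x))
      ; identity = λ {(A , _)} → unique A (free A) (L-map idʰ) idʰ (λ _ → refl)
      ; homomorphism = λ {(A , _)} {_} {(E , _)} {g} {k} →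
          unique A (free E) (L-map (k ∘ʰ g)) (L-map k ∘ʰ L-map g) (λ _ → refl)
      }
    ; unit = λ (M , _) → inclusion M
    ; unit-natural = λ _ _ → refl
    ; counit = λ (N , N∈) → ε N N∈
    ; counit-natural = λ {(A , A∈)} {(B , B∈)} g →
        unique (reduct f A) B (ε B B∈ ∘ʰ L-map (reductʰ f g)) (g ∘ʰ ε A A∈) (λ _ → Algebra.refl B)
    ; zig = λ (A , _) → unique A (free A) (ε (free A) (free-QV A) ∘ʰ L-map (inclusion A)) idʰ
        (λ _ → refl)
    ; zag = λ (B , _) _ → Algebra.refl B
    }

freeAdjoints : LeftAdjoints u
freeAdjoints h = Free.leftAdjoint h

module Glivenko (adj : LeftAdjoints u) where

  private
    module Adj {a a′ : AlgebraizableLogic u} (h : a ⟶ a′) = LeftAdjoint (adj h)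

  T : {a a′ : AlgebraizableLogic u} → a ⟶ a′ → Functor (QVᶜ a) (QVᶜ a)
  T h = h ⋆ ∘ᶠ Adj.L h

  Family : {a a′ : AlgebraizableLogic u} → a ⟶ a′ → Set (lsuc u)
  Family h = Components (T h) Idᶠ

  record IsContext {a a′ : AlgebraizableLogic u} (h : a ⟶ a′) (ρ : Family h) : Set (lsuc u) where
    field
      natural : IsNatural (T h) Idᶠ ρ
      section : ∀ M → Adj.unit h M ∘ʰ ρ M ≈ʰ idʰ

  record Context (a a′ : AlgebraizableLogic u) : Set (lsuc (lsuc u)) where
    field
      translation : a ⟶ a′
      family      : Family translation
      isContext   : IsContext translation family
  open Context

  -- No strictness is assumed of the choice of left adjoints.  Instead they are
  -- identified along the canonical morphisms induced by the universal property of
  -- the units: the adjoints of h and k when h ≈ᵗ k, the adjoint of a composite with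
  -- the composite of the adjoints, and the adjoint of the identity with the
  -- identity functor.  The reduct-… factors are identities on elements.
  module _ {a a′ : AlgebraizableLogic u} (h k : a ⟶ a′) (h≈k : h ≈ᵗ k)
           (M : Category.Obj (QVᶜ a)) where
    private LₖM = Adj.L₀ k M

    canonical-≈ : Hom (proj₁ (Adj.L₀ h M)) (proj₁ LₖM)
    canonical-≈ = Adj.transpose h {M} {LₖM}
      (reduct-cong (morphism k) (morphism h) (λ c → ≡.sym (h≈k c)) (proj₁ LₖM)
        ∘ʰ Adj.unit k M)

    T-canonical-≈ : Hom (proj₁ (Functor.F₀ (T h) M)) (proj₁ (Functor.F₀ (T k) M))
    T-canonical-≈ = reduct-cong (morphism h) (morphism k) h≈k (proj₁ LₖM)
      ∘ʰ reductʰ (morphism h) canonical-≈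

  module _ {a a′ a″ : AlgebraizableLogic u} (h′ : a′ ⟶ a″) (h : a ⟶ a′) where

    module _ (M : Category.Obj (QVᶜ a)) where
      private
        LM   = Adj.L₀ h M
        L′LM = Adj.L₀ h′ LM

      canonical-∘ : Hom (proj₁ (Adj.L₀ (h′ ∘ᵗ h) M)) (proj₁ L′LM)
      canonical-∘ = Adj.transpose (h′ ∘ᵗ h) {M} {L′LM}
        (reduct-∘⁻¹ (morphism h′) (morphism h) (proj₁ L′LM)
          ∘ʰ reductʰ (morphism h) (Adj.unit h′ LM) ∘ʰ Adj.unit h M)

      T-canonical-∘ : Hom (proj₁ (Functor.F₀ (T (h′ ∘ᵗ h)) M))
                          (proj₁ (Functor.F₀ (h ⋆ ∘ᶠ T h′ ∘ᶠ Adj.L h) M))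
      T-canonical-∘ = reduct-∘ (morphism h′) (morphism h) (proj₁ L′LM)
        ∘ʰ reductʰ (morphism (h′ ∘ᵗ h)) canonical-∘

    infixr 9 _•_
    _•_ : Family h′ → Family h → Family (h′ ∘ᵗ h)
    (ρ′ • ρ) M = ρ M ∘ʰ reductʰ (morphism h) (ρ′ (Adj.L₀ h M)) ∘ʰ T-canonical-∘ M

  module _ (a : AlgebraizableLogic u) (M : Category.Obj (QVᶜ a)) where

    canonical-id : Hom (proj₁ (Adj.L₀ (idᵗ {a = a}) M)) (proj₁ M)
    canonical-id = Adj.transpose (idᵗ {a = a}) {M} {M} (reduct-id⁻¹ (proj₁ M))

    ι : Hom (proj₁ (Functor.F₀ (T (idᵗ {a = a})) M)) (proj₁ M)
    ι = reduct-id (proj₁ M) ∘ʰ reductʰ idᵐ canonical-id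

  -- Contexts are equal when their translations are and the families agree after
  -- identifying the two chosen left adjoints.
  infix 4 _≈ᴳ_
  _≈ᴳ_ : {a a′ : AlgebraizableLogic u} → Rel (Context a a′) (lsuc u)
  H ≈ᴳ K = Σ[ h≈k ∈ translation H ≈ᵗ translation K ]
    (∀ M → family H M ≈ʰ family K M ∘ʰ T-canonical-≈ (translation H) (translation K) h≈k M)

  record GAf-isCategory : Set (lsuc (lsuc u)) where
    field
      ι-isContext : ∀ {a} → IsContext {a} {a} idᵗ (ι a)
      •-isContext : ∀ {a a′ a″} {h : a ⟶ a′} {h′ : a′ ⟶ a″} {ρ : Family h} {ρ′ : Family h′} →
                    IsContext {a} {a′} h ρ → IsContext {a′} {a″} h′ ρ′ →
                    IsContext {a} {a″} (h′ ∘ᵗ h) (_•_ {a} {a′} {a″} h′ h ρ′ ρ)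

    idᴳ : ∀ {a} → Context a a
    idᴳ {a} = record { translation = idᵗ {a = a} ; family = ι a ; isContext = ι-isContext {a} }

    _∘ᴳ_ : ∀ {a a′ a″} → Context a′ a″ → Context a a′ → Context a a″
    K ∘ᴳ H = record
      { translation = translation K ∘ᵗ translation H
      ; family      = _•_ (translation K) (translation H) (family K) (family H)
      ; isContext   = •-isContext (isContext H) (isContext K)
      }

    field
      isCategory : IsCategory (AlgebraizableLogic u) Context _≈ᴳ_ idᴳ _∘ᴳ_

{-# OPTIONS --safe #-}
-- All the identifications of left adjoints are morphisms out of some L_h M, so they are
-- determined by their values on the image of the unit; every coherence between them
-- is checked there.  What remains is naturality of the ρ's along these identifications.
-- For the section law of ρ′ • ρ, write c : L_{h′∘h} M → L_{h′} L_h M for the identification: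
-- the unit of h′ ∘ h is c⁻¹ ∘ ∂̄′ ∘ ∂̄, and c⁻¹ ∘ (∂̄′ ∘ ∂̄ ∘ ρ ∘ ρ′) ∘ c = c⁻¹ ∘ c = id.
module Submission where

open import Level using (Level)
open import Data.Product.Base using (_,_; proj₁; proj₂)
open import Data.Vec.Base using (Vec; []; _∷_; lookup; tabulate)
open import Data.Vec.Properties using (lookup∘tabulate)
open import Relation.Binary.PropositionalEquality as ≡ using (_≡_; refl)
open import Relation.Binary.Structures using (IsEquivalence)
import Relation.Binary.Reasoning.Setoid as SetoidReasoning
open import Defs

-- Composition of flexible morphisms: right unit law and congruence.

mutual
  []-var : ∀ {u x} {S : Signature u} {X : Set x} (t : Term S X) → t [ var ] ≡ t
  []-var (var i)   = refl
  []-var (op c ts) = ≡.cong (op c) ([]*-var ts)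

  []*-var : ∀ {u x n} {S : Signature u} {X : Set x} (ts : Vec (Term S X) n) → ts [ var ]* ≡ ts
  []*-var []       = refl
  []*-var (t ∷ ts) = ≡.cong₂ _∷_ ([]-var t) ([]*-var ts)

-- The composite sends `c` to `term (f c)` with its `i`-th variable replaced by the `i`-th entry of
-- `extend* f (tabulate var)`. That entry is again `var i`, so the substitution is the trivial one.
∘ᵐ-identityʳ : ∀ {u} {S S′ : Signature u} (f : FlexibleMorphism S S′) → f ∘ᵐ idᵐ ≈ᵐ f
∘ᵐ-identityʳ f c = ≡.trans
  ([]-cong (term (f c)) λ i → ≡.trans
    (lookup-extend* f (tabulate var) i)
    (≡.cong (extend f) (lookup∘tabulate var i)))
  ([]-var (term (f c)))

module _ {u} {S S′ : Signature u} (f g : FlexibleMorphism S S′) (f≈g : f ≈ᵐ g) where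

  mutual
    extend-cong : ∀ {x} {X : Set x} (t : Term S X) → extend f t ≡ extend g t
    extend-cong (var i)   = refl
    extend-cong (op c ts) = ≡.trans
      (≡.cong (_[ lookup (extend* f ts) ]) (f≈g c))
      ([]-cong (term (g c)) λ i → ≡.cong (λ us → lookup us i) (extend*-cong ts))

    extend*-cong : ∀ {x n} {X : Set x} (ts : Vec (Term S X) n) → extend* f ts ≡ extend* g ts
    extend*-cong []       = refl
    extend*-cong (t ∷ ts) = ≡.cong₂ _∷_ (extend-cong t) (extend*-cong ts)

∘ᵐ-cong : ∀ {u} {S S′ S″ : Signature u} (f f′ : FlexibleMorphism S′ S″)
          (g g′ : FlexibleMorphism S S′) → f ≈ᵐ f′ → g ≈ᵐ g′ → f ∘ᵐ g ≈ᵐ f′ ∘ᵐ g′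
∘ᵐ-cong f f′ g g′ f≈f′ g≈g′ c =
  ≡.trans (≡.cong (extend f) (g≈g′ c)) (extend-cong f f′ f≈f′ (term (g′ c)))

-- The universal property of the unit of an adjunction.

module _ {u} {a a′ : AlgebraizableLogic u} {h : a ⟶ a′} (adj : LeftAdjoint (h ⋆)) where
  private
    module Adj = LeftAdjoint adj
    open Category using (Obj)

  -- Naturality of the unit at `f` turns the left side into the counit after the unit at `h⋆ B`,
  -- applied to `f x`; `zag` cancels the two.
  transpose-unit : (A : Obj (QVᶜ a)) (B : Obj (QVᶜ a′))
                   (f : Hom (proj₁ A) (reduct (morphism h) (proj₁ B))) →
                   ∀ x → let open Algebra (proj₁ B) in
                   Hom.to (Adj.transpose {A} {B} f) (Hom.to (Adj.unit A) x) ≈ Hom.to f x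
  transpose-unit A B f x = B.trans
    (Hom.cong (Adj.counit B) (B′.sym (Adj.unit-natural {A} {Functor.F₀ (h ⋆) B} f x)))
    (Adj.zag B (Hom.to f x))
    where
    module B = Algebra (proj₁ B)
    module B′ = Algebra (proj₁ (Adj.L₀ (Functor.F₀ (h ⋆) B)))

  -- A morphism out of `L₀ A` is the transpose of its restriction along the unit (`recover`), hence
  -- determined by that restriction. The unit need not be surjective. Every coherence below is
  -- checked through this lemma.
  unit-epic : (A : Obj (QVᶜ a)) (B : Obj (QVᶜ a′)) (f g : Hom (proj₁ (Adj.L₀ A)) (proj₁ B)) →
              (∀ x → let open Algebra (proj₁ B) in
                 Hom.to f (Hom.to (Adj.unit A) x) ≈ Hom.to g (Hom.to (Adj.unit A) x)) →
              f ≈ʰ g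
  unit-epic A B f g p y = begin
    Hom.to f y
      ≈⟨ recover f y ⟨
    Hom.to (Adj.transpose {A} {B} (restrict f)) y
      -- `reductʰ` keeps the underlying function, so `p` is itself a proof of
      -- `restrict f ≈ʰ restrict g`.
      ≈⟨ Hom.cong (Adj.counit B)
           (Functor.F-resp-≈ Adj.L {A} {RB} {restrict f} {restrict g} p y) ⟩
    Hom.to (Adj.transpose {A} {B} (restrict g)) y
      ≈⟨ recover g y ⟩
    Hom.to g y ∎
    where
    module B = Algebra (proj₁ B)
    open SetoidReasoning B.setoid
    LA = Adj.L₀ A
    RB = Functor.F₀ (h ⋆) B
    restrict : Hom (proj₁ LA) (proj₁ B) → Hom (proj₁ A) (proj₁ RB)
    restrict k = reductʰ (morphism h) k ∘ʰ Adj.unit A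
    -- Functoriality splits `L₁` of the restriction, naturality of the counit moves `k` outside, and
    -- `zig` removes what is left.
    recover : ∀ k → Adj.transpose {A} {B} (restrict k) ≈ʰ k
    recover k y = begin
      Hom.to (Adj.counit B) (Hom.to (Adj.L₁ {A} {RB} (restrict k)) y)
        ≈⟨ Hom.cong (Adj.counit B) (Functor.homomorphism Adj.L {A} {Functor.F₀ (h ⋆) LA} {RB}
             {Adj.unit A} {reductʰ (morphism h) k} y) ⟩
      Hom.to (Adj.counit B)
        (Hom.to (Adj.L₁ (reductʰ (morphism h) k)) (Hom.to (Adj.L₁ (Adj.unit A)) y))
        ≈⟨ Adj.counit-natural {LA} {B} k (Hom.to (Adj.L₁ (Adj.unit A)) y) ⟩
      Hom.to k (Hom.to (Adj.counit LA) (Hom.to (Adj.L₁ (Adj.unit A)) y))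
        ≈⟨ Hom.cong k (Adj.zig A y) ⟩
      Hom.to k y ∎

module _ {u} (adj : LeftAdjoints u) where
  open Glivenko adj
  open Context
  private
    module Adj {a a′ : AlgebraizableLogic u} (h : a ⟶ a′) = LeftAdjoint (adj h)
    open Category using (Obj)

  -- Identification of the adjoints of equal translations.

  canonical-≈-unit : ∀ {a a′ : AlgebraizableLogic u} (h k : a ⟶ a′) (h≈k : h ≈ᵗ k)
    (M : Obj (QVᶜ a)) → ∀ x → let open Algebra (proj₁ (Adj.L₀ k M)) in
    Hom.to (canonical-≈ h k h≈k M) (Hom.to (Adj.unit h M) x) ≈ Hom.to (Adj.unit k M) x
  canonical-≈-unit h k h≈k M = transpose-unit (adj h) M (Adj.L₀ k M) _

  canonical-≈-refl : ∀ {a a′ : AlgebraizableLogic u} (h : a ⟶ a′) (h≈h : h ≈ᵗ h) (M : Obj (QVᶜ a)) →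
    canonical-≈ h h h≈h M ≈ʰ idʰ
  canonical-≈-refl h h≈h M =
    unit-epic (adj h) M (Adj.L₀ h M) (canonical-≈ h h h≈h M) idʰ (canonical-≈-unit h h h≈h M)

  -- The proof `h≈l` is arbitrary, because all three maps are fixed by their values on the unit.
  -- With `l = h` and `canonical-≈-refl` this makes the identifications invertible.
  canonical-≈-trans : ∀ {a a′ : AlgebraizableLogic u} (h k l : a ⟶ a′)
    (h≈k : h ≈ᵗ k) (k≈l : k ≈ᵗ l) (h≈l : h ≈ᵗ l) (M : Obj (QVᶜ a)) →
    canonical-≈ k l k≈l M ∘ʰ canonical-≈ h k h≈k M ≈ʰ canonical-≈ h l h≈l M
  canonical-≈-trans h k l h≈k k≈l h≈l M = unit-epic (adj h) M (Adj.L₀ l M)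
    (canonical-≈ k l k≈l M ∘ʰ canonical-≈ h k h≈k M) (canonical-≈ h l h≈l M) λ x → begin
    Hom.to (canonical-≈ k l k≈l M) (Hom.to (canonical-≈ h k h≈k M) (Hom.to (Adj.unit h M) x))
      ≈⟨ Hom.cong (canonical-≈ k l k≈l M) (canonical-≈-unit h k h≈k M x) ⟩
    Hom.to (canonical-≈ k l k≈l M) (Hom.to (Adj.unit k M) x)
      ≈⟨ canonical-≈-unit k l k≈l M x ⟩
    Hom.to (Adj.unit l M) x
      ≈⟨ canonical-≈-unit h l h≈l M x ⟨
    Hom.to (canonical-≈ h l h≈l M) (Hom.to (Adj.unit h M) x) ∎
    where open SetoidReasoning (Algebra.setoid (proj₁ (Adj.L₀ l M)))

  -- The identity context.

  module _ {a : AlgebraizableLogic u} where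

    private
      i : a ⟶ a
      i = idᵗ

    canonical-id-unit : (M : Obj (QVᶜ a)) → ∀ x → let open Algebra (proj₁ M) in
      Hom.to (canonical-id a M) (Hom.to (Adj.unit i M) x) ≈ x
    canonical-id-unit M = transpose-unit (adj i) M M _

    ι-context : IsContext {a} {a} idᵗ (ι a)
    ι-context = record
      { natural = λ {M} {N} f → unit-epic (adj i) M N
          (canonical-id a N ∘ʰ Adj.L₁ i {M} {N} f) (f ∘ʰ canonical-id a M) λ x →
          let open SetoidReasoning (Algebra.setoid (proj₁ N)) in begin
          Hom.to (canonical-id a N) (Hom.to (Adj.L₁ i {M} {N} f) (Hom.to (Adj.unit i M) x))
            ≈⟨ Hom.cong (canonical-id a N) (Adj.unit-natural i {M} {N} f x) ⟨
          Hom.to (canonical-id a N) (Hom.to (Adj.unit i N) (Hom.to f x))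
            ≈⟨ canonical-id-unit N _ ⟩
          Hom.to f x
            ≈⟨ Hom.cong f (canonical-id-unit M x) ⟨
          Hom.to f (Hom.to (canonical-id a M) (Hom.to (Adj.unit i M) x)) ∎
      ; section = λ M → let LM = Adj.L₀ i M in
          -- The composite of `canonical-id` with the unit lands in the reduct of `LM` along `idᵐ`.
          -- Postcomposing with `reduct-id`, the identity on elements, gives an endomorphism of
          -- `LM`, to which `unit-epic` applies.
          unit-epic (adj i) M LM
            (reduct-id (proj₁ LM) ∘ʰ Adj.unit i M ∘ʰ canonical-id a M) idʰ
            λ x → Hom.cong (Adj.unit i M) (canonical-id-unit M x)
      }

  -- Composition of contexts.

  module _ {a a′ a″ : AlgebraizableLogic u} (h′ : a′ ⟶ a″) (h : a ⟶ a′) where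
    private
      hh = h′ ∘ᵗ h
      L′L₀ : Obj (QVᶜ a) → Obj (QVᶜ a″)
      L′L₀ M = Adj.L₀ h′ (Adj.L₀ h M)
      L′L₁ : ∀ {M N} → Hom (proj₁ M) (proj₁ N) → Hom (proj₁ (L′L₀ M)) (proj₁ (L′L₀ N))
      L′L₁ {M} {N} f = Adj.L₁ h′ {Adj.L₀ h M} {Adj.L₀ h N} (Adj.L₁ h {M} {N} f)

    canonical-∘-unit : (M : Obj (QVᶜ a)) → ∀ x → let open Algebra (proj₁ (L′L₀ M)) in
      Hom.to (canonical-∘ h′ h M) (Hom.to (Adj.unit hh M) x)
        ≈ Hom.to (Adj.unit h′ (Adj.L₀ h M)) (Hom.to (Adj.unit h M) x)
    canonical-∘-unit M = transpose-unit (adj hh) M (L′L₀ M) _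

    -- On the image of the unit both sides become the two successive units composed with `f`, by
    -- naturality of the units of `h′ ∘ᵗ h`, `h` and `h′`.
    canonical-∘-natural : ∀ {M N} (f : Hom (proj₁ M) (proj₁ N)) →
      canonical-∘ h′ h N ∘ʰ Adj.L₁ hh {M} {N} f ≈ʰ L′L₁ {M} {N} f ∘ʰ canonical-∘ h′ h M
    canonical-∘-natural {M} {N} f = unit-epic (adj hh) M (L′L₀ N)
      (canonical-∘ h′ h N ∘ʰ Adj.L₁ hh {M} {N} f)
      (L′L₁ {M} {N} f ∘ʰ canonical-∘ h′ h M) λ x → begin
      Hom.to (canonical-∘ h′ h N) (Hom.to (Adj.L₁ hh {M} {N} f) (Hom.to (Adj.unit hh M) x))
        ≈⟨ Hom.cong (canonical-∘ h′ h N) (Adj.unit-natural hh {M} {N} f x) ⟨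
      Hom.to (canonical-∘ h′ h N) (Hom.to (Adj.unit hh N) (Hom.to f x))
        ≈⟨ canonical-∘-unit N _ ⟩
      Hom.to (Adj.unit h′ (Adj.L₀ h N)) (Hom.to (Adj.unit h N) (Hom.to f x))
        ≈⟨ Hom.cong (Adj.unit h′ (Adj.L₀ h N)) (Adj.unit-natural h {M} {N} f x) ⟩
      Hom.to (Adj.unit h′ (Adj.L₀ h N)) (Hom.to (Adj.L₁ h {M} {N} f) (Hom.to (Adj.unit h M) x))
        ≈⟨ Adj.unit-natural h′ {Adj.L₀ h M} {Adj.L₀ h N} (Adj.L₁ h {M} {N} f) _ ⟩
      Hom.to (L′L₁ {M} {N} f) (Hom.to (Adj.unit h′ (Adj.L₀ h M)) (Hom.to (Adj.unit h M) x))
        ≈⟨ Hom.cong (L′L₁ {M} {N} f) (canonical-∘-unit M x) ⟨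
      Hom.to (L′L₁ {M} {N} f) (Hom.to (canonical-∘ h′ h M) (Hom.to (Adj.unit hh M) x)) ∎
      where open SetoidReasoning (Algebra.setoid (proj₁ (L′L₀ N)))

    module _ (M : Obj (QVᶜ a)) where
      private
        LM  = Adj.L₀ h M
        L″M = Adj.L₀ hh M
        RL″M = Functor.F₀ (h′ ⋆) L″M

        half : Hom (proj₁ LM) (proj₁ RL″M)
        half = Adj.transpose h {M} {RL″M}
          (reduct-∘ (morphism h′) (morphism h) (proj₁ L″M) ∘ʰ Adj.unit hh M)

      -- The unit of `h′ ∘ᵗ h` is transposed twice: across `h`, which gives `half`, and then across
      -- `h′`.
      canonical-∘⁻¹ : Hom (proj₁ (L′L₀ M)) (proj₁ L″M)
      canonical-∘⁻¹ = Adj.transpose h′ {LM} {L″M} half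

      canonical-∘⁻¹-unit : ∀ x → let open Algebra (proj₁ L″M) in
        Hom.to canonical-∘⁻¹ (Hom.to (Adj.unit h′ LM) (Hom.to (Adj.unit h M) x))
          ≈ Hom.to (Adj.unit hh M) x
      canonical-∘⁻¹-unit x = Algebra.trans (proj₁ L″M)
        (transpose-unit (adj h′) LM L″M half _)
        (transpose-unit (adj h) M RL″M _ x)

      canonical-∘⁻¹-∘ : canonical-∘⁻¹ ∘ʰ canonical-∘ h′ h M ≈ʰ idʰ
      canonical-∘⁻¹-∘ = unit-epic (adj hh) M L″M
        (canonical-∘⁻¹ ∘ʰ canonical-∘ h′ h M) idʰ λ x → Algebra.trans (proj₁ L″M)
        (Hom.cong canonical-∘⁻¹ (canonical-∘-unit M x))
        (canonical-∘⁻¹-unit x)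

    -- The maps `reductʰ` and `reduct-∘` are identities on elements, so they disappear from the
    -- elementwise chains. Naturality passes `f` through the identification, then through `ρ′` in
    -- the form `L₁ h f`, and finally through `ρ`.
    •-context : ∀ {ρ : Family h} {ρ′ : Family h′} → IsContext h ρ → IsContext h′ ρ′ →
                IsContext hh (_•_ h′ h ρ′ ρ)
    •-context {ρ} {ρ′} ctx ctx′ = record
      { natural = λ {M} {N} f y → let open SetoidReasoning (Algebra.setoid (proj₁ N)) in begin
          Hom.to (ρ N) (Hom.to (ρ′ (Adj.L₀ h N))
              (Hom.to (canonical-∘ h′ h N) (Hom.to (Adj.L₁ hh {M} {N} f) y)))
            ≈⟨ Hom.cong (ρ N) (Hom.cong (ρ′ (Adj.L₀ h N)) (canonical-∘-natural {M} {N} f y)) ⟩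
          Hom.to (ρ N) (Hom.to (ρ′ (Adj.L₀ h N))
              (Hom.to (L′L₁ {M} {N} f) (Hom.to (canonical-∘ h′ h M) y)))
            ≈⟨ Hom.cong (ρ N) (IsContext.natural ctx′ {Adj.L₀ h M} {Adj.L₀ h N}
                 (Adj.L₁ h {M} {N} f) (Hom.to (canonical-∘ h′ h M) y)) ⟩
          Hom.to (ρ N) (Hom.to (Adj.L₁ h {M} {N} f)
              (Hom.to (ρ′ (Adj.L₀ h M)) (Hom.to (canonical-∘ h′ h M) y)))
            ≈⟨ IsContext.natural ctx {M} {N} f
                 (Hom.to (ρ′ (Adj.L₀ h M)) (Hom.to (canonical-∘ h′ h M) y)) ⟩
          Hom.to f (Hom.to (ρ M)
              (Hom.to (ρ′ (Adj.L₀ h M)) (Hom.to (canonical-∘ h′ h M) y))) ∎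
      ; section = λ M y → let
            L″M = Adj.L₀ hh M
            LM = Adj.L₀ h M
            d  = canonical-∘⁻¹ M
            z  = Hom.to (canonical-∘ h′ h M) y
            open SetoidReasoning (Algebra.setoid (proj₁ L″M)) in begin
          Hom.to (Adj.unit hh M) (Hom.to (ρ M) (Hom.to (ρ′ LM) z))
            -- Splitting the unit of the composite puts the unit of `h` next to `ρ M`; once that
            -- pair cancels, the unit of `h′` meets `ρ′ LM`.
            ≈⟨ canonical-∘⁻¹-unit M _ ⟨
          Hom.to d (Hom.to (Adj.unit h′ LM) (Hom.to (Adj.unit h M)
              (Hom.to (ρ M) (Hom.to (ρ′ LM) z))))
            ≈⟨ Hom.cong d (Hom.cong (Adj.unit h′ LM) (IsContext.section ctx M (Hom.to (ρ′ LM) z))) ⟩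
          Hom.to d (Hom.to (Adj.unit h′ LM) (Hom.to (ρ′ LM) z))
            ≈⟨ Hom.cong d (IsContext.section ctx′ LM z) ⟩
          Hom.to d z
            ≈⟨ canonical-∘⁻¹-∘ M y ⟩
          y ∎
      }

  -- Equality of contexts is an equivalence relation.

  ≈ᴳ-isEquivalence : ∀ {a a′} → IsEquivalence (_≈ᴳ_ {a} {a′})
  ≈ᴳ-isEquivalence = record
    { refl = λ {H} → (λ c → refl) , λ M y →
        Algebra.sym (proj₁ M) (Hom.cong (family H M)
          (canonical-≈-refl (translation H) (λ c → refl) M y))
    ; sym = λ {H} {K} (h≈k , p) →
        let h = translation H
            k = translation K
            k≈h : k ≈ᵗ h
            k≈h c = ≡.sym (h≈k c)
        in k≈h , λ M y →
        let open SetoidReasoning (Algebra.setoid (proj₁ M))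
            c⁻¹y = Hom.to (canonical-≈ k h k≈h M) y
        in begin
        Hom.to (family K M) y
          -- The identity is inserted before `family K M` and factored through the adjoint of `h`,
          -- so that the hypothesis `p` applies at `c⁻¹y`.
          ≈⟨ Hom.cong (family K M) (canonical-≈-refl k (λ c → refl) M y) ⟨
        Hom.to (family K M) (Hom.to (canonical-≈ k k (λ c → refl) M) y)
          ≈⟨ Hom.cong (family K M) (canonical-≈-trans k h k k≈h h≈k (λ c → refl) M y) ⟨
        Hom.to (family K M) (Hom.to (canonical-≈ h k h≈k M) c⁻¹y)
          ≈⟨ p M c⁻¹y ⟨
        Hom.to (family H M) c⁻¹y ∎
    ; trans = λ {H} {K} {J} (h≈k , p) (k≈j , q) →
        let h = translation H
            k = translation K
            j = translation J
            h≈j : h ≈ᵗ j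
            h≈j c = ≡.trans (h≈k c) (k≈j c)
        in h≈j , λ M y →
        let open SetoidReasoning (Algebra.setoid (proj₁ M))
            cy = Hom.to (canonical-≈ h k h≈k M) y
        in begin
        Hom.to (family H M) y
          ≈⟨ p M y ⟩
        Hom.to (family K M) cy
          ≈⟨ q M cy ⟩
        Hom.to (family J M) (Hom.to (canonical-≈ k j k≈j M) cy)
          ≈⟨ Hom.cong (family J M) (canonical-≈-trans h k j h≈k k≈j h≈j M y) ⟩
        Hom.to (family J M) (Hom.to (canonical-≈ h j h≈j M) y) ∎
    }

  -- Coherence of the identifications with associativity, units and congruence.

  canonical-∘-assoc : ∀ {a b c d : AlgebraizableLogic u} (h : c ⟶ d) (g : b ⟶ c) (f : a ⟶ b)
    (e : (h ∘ᵗ g) ∘ᵗ f ≈ᵗ h ∘ᵗ (g ∘ᵗ f)) (M : Obj (QVᶜ a)) →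
    canonical-∘ h g (Adj.L₀ f M) ∘ʰ canonical-∘ (h ∘ᵗ g) f M
      ≈ʰ Adj.L₁ h {Adj.L₀ (g ∘ᵗ f) M} {Adj.L₀ g (Adj.L₀ f M)} (canonical-∘ g f M)
         ∘ʰ canonical-∘ h (g ∘ᵗ f) M ∘ʰ canonical-≈ ((h ∘ᵗ g) ∘ᵗ f) (h ∘ᵗ (g ∘ᵗ f)) e M
  canonical-∘-assoc h g f e M = unit-epic (adj hg-f) M (Adj.L₀ h L′LM)
    (canonical-∘ h g LM ∘ʰ canonical-∘ hg f M)
    (L₁c ∘ʰ canonical-∘ h gf M ∘ʰ canonical-≈ hg-f h-gf e M) λ x → begin
    Hom.to (canonical-∘ h g LM) (Hom.to (canonical-∘ hg f M) (Hom.to (Adj.unit hg-f M) x))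
      ≈⟨ Hom.cong (canonical-∘ h g LM) (canonical-∘-unit hg f M x) ⟩
    Hom.to (canonical-∘ h g LM) (Hom.to (Adj.unit hg LM) (Hom.to (Adj.unit f M) x))
      ≈⟨ canonical-∘-unit h g LM _ ⟩
    Hom.to (Adj.unit h L′LM) (Hom.to (Adj.unit g LM) (Hom.to (Adj.unit f M) x))
      ≈⟨ Hom.cong (Adj.unit h L′LM) (canonical-∘-unit g f M x) ⟨
    Hom.to (Adj.unit h L′LM) (Hom.to (canonical-∘ g f M) (Hom.to (Adj.unit gf M) x))
      -- Both sides reduce to the three successive units of `f`, `g` and `h`. On the right,
      -- `canonical-∘ g f M` occurs under `L₁ h`, and naturality of the unit of `h` brings it out.
      ≈⟨ Adj.unit-natural h {Adj.L₀ gf M} {L′LM} (canonical-∘ g f M) _ ⟩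
    Hom.to L₁c (Hom.to (Adj.unit h (Adj.L₀ gf M)) (Hom.to (Adj.unit gf M) x))
      ≈⟨ Hom.cong L₁c (canonical-∘-unit h gf M x) ⟨
    Hom.to L₁c (Hom.to (canonical-∘ h gf M) (Hom.to (Adj.unit h-gf M) x))
      ≈⟨ Hom.cong L₁c (Hom.cong (canonical-∘ h gf M) (canonical-≈-unit hg-f h-gf e M x)) ⟨
    Hom.to L₁c (Hom.to (canonical-∘ h gf M)
      (Hom.to (canonical-≈ hg-f h-gf e M) (Hom.to (Adj.unit hg-f M) x))) ∎
    where
    hg = h ∘ᵗ g
    gf = g ∘ᵗ f
    hg-f = hg ∘ᵗ f
    h-gf = h ∘ᵗ gf
    LM   = Adj.L₀ f M
    L′LM = Adj.L₀ g LM
    L₁c  = Adj.L₁ h {Adj.L₀ gf M} {L′LM} (canonical-∘ g f M)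
    open SetoidReasoning (Algebra.setoid (proj₁ (Adj.L₀ h L′LM)))

  canonical-∘-identityˡ : ∀ {a a′ : AlgebraizableLogic u} (f : a ⟶ a′)
    (e : idᵗ ∘ᵗ f ≈ᵗ f) (M : Obj (QVᶜ a)) →
    canonical-id a′ (Adj.L₀ f M) ∘ʰ canonical-∘ idᵗ f M ≈ʰ canonical-≈ (idᵗ ∘ᵗ f) f e M
  canonical-∘-identityˡ {a} {a′} f e M = unit-epic (adj (idᵗ ∘ᵗ f)) M LM
    (canonical-id a′ LM ∘ʰ canonical-∘ idᵗ f M) (canonical-≈ (idᵗ ∘ᵗ f) f e M) λ x → begin
    Hom.to (canonical-id a′ LM) (Hom.to (canonical-∘ idᵗ f M) (Hom.to (Adj.unit (idᵗ ∘ᵗ f) M) x))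
      ≈⟨ Hom.cong (canonical-id a′ LM) (canonical-∘-unit idᵗ f M x) ⟩
    Hom.to (canonical-id a′ LM) (Hom.to (Adj.unit idᵗ LM) (Hom.to (Adj.unit f M) x))
      ≈⟨ canonical-id-unit LM _ ⟩
    Hom.to (Adj.unit f M) x
      ≈⟨ canonical-≈-unit (idᵗ ∘ᵗ f) f e M x ⟨
    Hom.to (canonical-≈ (idᵗ ∘ᵗ f) f e M) (Hom.to (Adj.unit (idᵗ ∘ᵗ f) M) x) ∎
    where
    LM = Adj.L₀ f M
    open SetoidReasoning (Algebra.setoid (proj₁ LM))

  -- Unlike in the left law, `canonical-id` here sits under `L₁ f`; naturality of the unit of `f`
  -- brings it to where it cancels the unit of `idᵗ`.
  canonical-∘-identityʳ : ∀ {a a′ : AlgebraizableLogic u} (f : a ⟶ a′)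
    (e : f ∘ᵗ idᵗ ≈ᵗ f) (M : Obj (QVᶜ a)) →
    Adj.L₁ f {Adj.L₀ idᵗ M} {M} (canonical-id a M) ∘ʰ canonical-∘ f idᵗ M
      ≈ʰ canonical-≈ (f ∘ᵗ idᵗ) f e M
  canonical-∘-identityʳ {a} {a′} f e M = unit-epic (adj (f ∘ᵗ idᵗ)) M (Adj.L₀ f M)
    (L₁c ∘ʰ canonical-∘ f idᵗ M) (canonical-≈ (f ∘ᵗ idᵗ) f e M) λ x → begin
    Hom.to L₁c (Hom.to (canonical-∘ f idᵗ M) (Hom.to (Adj.unit (f ∘ᵗ idᵗ) M) x))
      ≈⟨ Hom.cong L₁c (canonical-∘-unit f idᵗ M x) ⟩
    Hom.to L₁c (Hom.to (Adj.unit f (Adj.L₀ idᵗ M)) (Hom.to (Adj.unit idᵗ M) x))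
      ≈⟨ Adj.unit-natural f {Adj.L₀ idᵗ M} {M} (canonical-id a M) _ ⟨
    Hom.to (Adj.unit f M) (Hom.to (canonical-id a M) (Hom.to (Adj.unit idᵗ M) x))
      ≈⟨ Hom.cong (Adj.unit f M) (canonical-id-unit M x) ⟩
    Hom.to (Adj.unit f M) x
      ≈⟨ canonical-≈-unit (f ∘ᵗ idᵗ) f e M x ⟨
    Hom.to (canonical-≈ (f ∘ᵗ idᵗ) f e M) (Hom.to (Adj.unit (f ∘ᵗ idᵗ) M) x) ∎
    where
    L₁c = Adj.L₁ f {Adj.L₀ idᵗ M} {M} (canonical-id a M)
    open SetoidReasoning (Algebra.setoid (proj₁ (Adj.L₀ f M)))

  -- This is naturality of `canonical-∘` in the two translations: both sides send the unit to the
  -- unit of `g′` followed by that of `f′`.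
  canonical-∘-cong : ∀ {a b c : AlgebraizableLogic u} (f f′ : b ⟶ c) (g g′ : a ⟶ b)
    (f≈f′ : f ≈ᵗ f′) (g≈g′ : g ≈ᵗ g′) (e : f ∘ᵗ g ≈ᵗ f′ ∘ᵗ g′) (M : Obj (QVᶜ a)) →
    Adj.L₁ f′ {Adj.L₀ g M} {Adj.L₀ g′ M} (canonical-≈ g g′ g≈g′ M)
      ∘ʰ canonical-≈ f f′ f≈f′ (Adj.L₀ g M) ∘ʰ canonical-∘ f g M
    ≈ʰ canonical-∘ f′ g′ M ∘ʰ canonical-≈ (f ∘ᵗ g) (f′ ∘ᵗ g′) e M
  canonical-∘-cong f f′ g g′ f≈f′ g≈g′ e M = unit-epic (adj fg) M (Adj.L₀ f′ L′M)
    (L₁c ∘ʰ cf ∘ʰ canonical-∘ f g M) (canonical-∘ f′ g′ M ∘ʰ cfg) λ x → begin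
    Hom.to L₁c (Hom.to cf (Hom.to (canonical-∘ f g M) (Hom.to (Adj.unit fg M) x)))
      ≈⟨ Hom.cong L₁c (Hom.cong cf (canonical-∘-unit f g M x)) ⟩
    Hom.to L₁c (Hom.to cf (Hom.to (Adj.unit f LM) (Hom.to (Adj.unit g M) x)))
      ≈⟨ Hom.cong L₁c (canonical-≈-unit f f′ f≈f′ LM _) ⟩
    Hom.to L₁c (Hom.to (Adj.unit f′ LM) (Hom.to (Adj.unit g M) x))
      ≈⟨ Adj.unit-natural f′ {LM} {L′M} cg _ ⟨
    Hom.to (Adj.unit f′ L′M) (Hom.to cg (Hom.to (Adj.unit g M) x))
      ≈⟨ Hom.cong (Adj.unit f′ L′M) (canonical-≈-unit g g′ g≈g′ M x) ⟩
    Hom.to (Adj.unit f′ L′M) (Hom.to (Adj.unit g′ M) x)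
      ≈⟨ canonical-∘-unit f′ g′ M x ⟨
    Hom.to (canonical-∘ f′ g′ M) (Hom.to (Adj.unit f′g′ M) x)
      ≈⟨ Hom.cong (canonical-∘ f′ g′ M) (canonical-≈-unit fg f′g′ e M x) ⟨
    Hom.to (canonical-∘ f′ g′ M) (Hom.to cfg (Hom.to (Adj.unit fg M) x)) ∎
    where
    fg   = f ∘ᵗ g
    f′g′ = f′ ∘ᵗ g′
    LM   = Adj.L₀ g M
    L′M  = Adj.L₀ g′ M
    cg   = canonical-≈ g g′ g≈g′ M
    cf   = canonical-≈ f f′ f≈f′ LM
    cfg  = canonical-≈ fg f′g′ e M
    L₁c  = Adj.L₁ f′ {LM} {L′M} cg
    open SetoidReasoning (Algebra.setoid (proj₁ (Adj.L₀ f′ L′M)))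

-- The category laws for contexts.

theorem5p1 : {u : Level} (adj : LeftAdjoints u) → Glivenko.GAf-isCategory adj
theorem5p1 {u} adj = record
  { ι-isContext = ι-context adj
  ; •-isContext = λ {_} {_} {_} {h} {h′} → •-context adj h′ h
  ; isCategory  = record
    { equiv    = ≈ᴳ-isEquivalence adj
    ; ∙-resp-≈ = λ {a} {_} {_} {F} {F′} {G} {G′} (f≈f′ , p) (g≈g′ , q) →
        let f  = translation F
            f′ = translation F′
            g  = translation G
            g′ = translation G′
            e : f ∘ᵗ g ≈ᵗ f′ ∘ᵗ g′
            e = ∘ᵐ-cong (morphism f) (morphism f′) (morphism g) (morphism g′) f≈f′ g≈g′
        in e , λ M y →
        let open SetoidReasoning (Algebra.setoid (proj₁ M))
            LM  = Adj.L₀ g M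
            L′M = Adj.L₀ g′ M
            cg  = canonical-≈ g g′ g≈g′ M
            z   = Hom.to (canonical-∘ f g M) y
            cz  = Hom.to (canonical-≈ f f′ f≈f′ LM) z
        in begin
        Hom.to (family G M) (Hom.to (family F LM) z)
          ≈⟨ Hom.cong (family G M) (p LM z) ⟩
        Hom.to (family G M) (Hom.to (family F′ LM) cz)
          ≈⟨ q M _ ⟩
        Hom.to (family G′ M) (Hom.to cg (Hom.to (family F′ LM) cz))
          -- After `p` and `q`, the map `cg` separates the two families. Naturality of `family F′`
          -- at `cg` moves it inward, next to the other identifications.
          ≈⟨ Hom.cong (family G′ M) (IsContext.natural (isContext F′) {LM} {L′M} cg cz) ⟨
        Hom.to (family G′ M) (Hom.to (family F′ L′M) (Hom.to (Adj.L₁ f′ {LM} {L′M} cg) cz))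
          ≈⟨ Hom.cong (family G′ M) (Hom.cong (family F′ L′M)
               (canonical-∘-cong adj f f′ g g′ f≈f′ g≈g′ e M y)) ⟩
        Hom.to (family G′ M) (Hom.to (family F′ L′M) (Hom.to (canonical-∘ f′ g′ M)
          (Hom.to (canonical-≈ (f ∘ᵗ g) (f′ ∘ᵗ g′) e M) y))) ∎
    ; assoc = λ {_} {_} {_} {_} {F} {G} {H} →
        let f = translation F
            g = translation G
            h = translation H
            e : (h ∘ᵗ g) ∘ᵗ f ≈ᵗ h ∘ᵗ (g ∘ᵗ f)
            e c = extend-∘ (morphism h) (morphism g) (term (morphism f c))
        in e , λ M y →
        let open SetoidReasoning (Algebra.setoid (proj₁ M))
            LM   = Adj.L₀ f M
            L′LM = Adj.L₀ g LM
            L″M  = Adj.L₀ (g ∘ᵗ f) M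
            c    = canonical-∘ g f M
            z    = Hom.to (canonical-∘ h (g ∘ᵗ f) M)
                     (Hom.to (canonical-≈ ((h ∘ᵗ g) ∘ᵗ f) (h ∘ᵗ (g ∘ᵗ f)) e M) y)
        in begin
        Hom.to (family F M) (Hom.to (family G LM) (Hom.to (family H L′LM)
          (Hom.to (canonical-∘ h g LM) (Hom.to (canonical-∘ (h ∘ᵗ g) f M) y))))
          ≈⟨ Hom.cong (family F M) (Hom.cong (family G LM) (Hom.cong (family H L′LM)
               (canonical-∘-assoc adj h g f e M y))) ⟩
        Hom.to (family F M) (Hom.to (family G LM) (Hom.to (family H L′LM)
          (Hom.to (Adj.L₁ h {L″M} {L′LM} c) z)))
          -- The two bracketings apply `family H` at `L′LM` and at `L″M`; its naturality along `c`
          -- relates them.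
          ≈⟨ Hom.cong (family F M) (Hom.cong (family G LM)
               (IsContext.natural (isContext H) {L″M} {L′LM} c z)) ⟩
        Hom.to (family F M) (Hom.to (family G LM) (Hom.to c (Hom.to (family H L″M) z))) ∎
    ; identityˡ = λ {_} {_} {F} →
        let f = translation F
            e : idᵗ ∘ᵗ f ≈ᵗ f
            e c = extend-id (term (morphism f c))
        -- On elements `ι` is `canonical-id`, so the law is the left unit coherence under
        -- `family F M`.
        in e , λ M y → Hom.cong (family F M) (canonical-∘-identityˡ adj f e M y)
    ; identityʳ = λ {a} {_} {F} →
        let f = translation F
            e : f ∘ᵗ idᵗ ≈ᵗ f
            e = ∘ᵐ-identityʳ (morphism f)
        in e , λ M y →
        let open SetoidReasoning (Algebra.setoid (proj₁ M))
            LM = Adj.L₀ idᵗ M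
            z  = Hom.to (canonical-∘ f idᵗ M) y
        in begin
        Hom.to (ι a M) (Hom.to (family F LM) z)
          -- Here `ι` stands outside `family F`; naturality exchanges them, turning `ι` into `L₁ f`
          -- of `canonical-id` so that the right unit coherence applies.
          ≈⟨ IsContext.natural (isContext F) {LM} {M} (canonical-id a M) z ⟨
        Hom.to (family F M) (Hom.to (Adj.L₁ f {LM} {M} (canonical-id a M)) z)
          ≈⟨ Hom.cong (family F M) (canonical-∘-identityʳ adj f e M y) ⟩
        Hom.to (family F M) (Hom.to (canonical-≈ (f ∘ᵗ idᵗ) f e M) y) ∎
    }
  }
  where
  open Glivenko adj
  open Context
  module Adj {a a′ : AlgebraizableLogic u} (h : a ⟶ a′) = LeftAdjoint (adj h)
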